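{- There is an identity tester with running time $\tilde O(\sqrt{n}\cdot\mathrm{poly}(1/\varepsilon))$. (It is obtained by modifying the tester of Batu, Fortnow, Fischer, Kumar, Rubinfeld and White, which uses $\tilde O(\sqrt{n}\cdot\mathrm{poly}(1/\varepsilon))$ samples but has running time $O(n)+\tilde O(\sqrt{n}\cdot\mathrm{poly}(1/\varepsilon))$.)
   Context: For a positive integer $n$, $[n]=\{1,2,\dots,n\}$. Let $p$ and $q$ be two probability distributions on $[n]$, and let $\|p-q\|_1$ denote the $\ell_1$-distance between them. Algorithms have access to $p$ and $q$ as follows. The distribution $p$ is known: for each $i\in[n]$, the algorithm can query the probability $p_i$ of $i$ in constant time. The distribution $q$ is unknown: the algorithm can only obtain an independent sample from $q$ in constant time. An identity tester (with parameter $\varepsilon$) is an algorithm such that: if $p=q$, then it accepts with probability $2/3$; if $\|p-q\|_1\ge\varepsilon$, then it rejects with probability $2/3$. -}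

module Defs where

open import Level as Level using (Level; _⊔_)
open import Algebra.Bundles using (CommutativeRing)
open import Algebra.Definitions.RawMonoid using (sum)
open import Data.Bool.Base using (Bool; if_then_else_)
open import Data.Fin.Base using (Fin; toℕ; fromℕ<)
open import Data.List.Base using (List; []; _∷_; _++_)
open import Data.Nat.Base as ℕ using (ℕ; zero; suc; _∸_)
open import Data.Nat.Logarithm using (⌊log₂_⌋)
open import Data.Nat.Properties using (_<?_)
open import Data.Product.Base using (∃-syntax; _×_)
open import Relation.Binary.Structures using (IsDecTotalOrder)
open import Relation.Nullary.Decidable.Core using (yes; no; ⌊_⌋)
open import Relation.Nullary.Negation.Core using (¬_)
import Algebra.Definitions.RawMonoid as RawMonoidDefs
import Algebra.Properties.Semiring.Exp as SemiringExp

------------------------------------------------------------------------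
-- Real numbers

-- The library has no real numbers.  We use Archimedean ordered fields with
-- a decidable order; classically ℝ is one (and ℚ is another).
record OrderedField (c ℓ₁ ℓ₂ : Level) : Set (Level.suc (c ⊔ ℓ₁ ⊔ ℓ₂)) where
  infix  4 _≤_ _<_
  infix  8 _⁻¹
  field
    commutativeRing : CommutativeRing c ℓ₁

  open CommutativeRing commutativeRing public

  -- The image of a natural number: 1# + ⋯ + 1#.
  fromℕ : ℕ → Carrier
  fromℕ n = RawMonoidDefs._×_ +-rawMonoid n 1#

  field
    _≤_             : Carrier → Carrier → Set ℓ₂
    isDecTotalOrder : IsDecTotalOrder _≈_ _≤_
    +-monoʳ-≤       : ∀ x {y z} → y ≤ z → x + y ≤ x + z
    *-nonNeg        : ∀ {x y} → 0# ≤ x → 0# ≤ y → 0# ≤ x * y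
    0≉1             : ¬ (0# ≈ 1#)
    -- A total function, with unspecified value at 0#.
    _⁻¹             : Carrier → Carrier
    ⁻¹-cong         : ∀ {x y} → x ≈ y → x ⁻¹ ≈ y ⁻¹
    *-inverseʳ      : ∀ x → ¬ (x ≈ 0#) → x * x ⁻¹ ≈ 1#
    archimedean     : ∀ x → ∃[ n ] x ≤ fromℕ n

  open IsDecTotalOrder isDecTotalOrder public using (_≤?_)

  _<_ : Carrier → Carrier → Set (ℓ₁ ⊔ ℓ₂)
  x < y = x ≤ y × ¬ (x ≈ y)

  ∣_∣ : Carrier → Carrier
  ∣ x ∣ = if ⌊ 0# ≤? x ⌋ then x else - x

  open SemiringExp semiring public using (_^_)

------------------------------------------------------------------------
-- Randomised algorithms: unit-cost random access machine programs over two
-- memories, one with integer cells and one with real cells, both addressed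
-- by naturals and both allowing indirect addressing.

infix  4 _≤ᵢ_ _≤ᵣ_
infixr 6 int[_]≔_ real[_]≔_
infixl 7 _⊕_ _⊖_ _⊞_ _⊟_
infixl 8 _⊠_ _⊘_

data IntExpr : Set where
  lit     : ℕ → IntExpr
  int[_]  : IntExpr → IntExpr
  _⊕_ _⊖_ : IntExpr → IntExpr → IntExpr

data RealExpr : Set where
  cast    : IntExpr → RealExpr
  real[_] : IntExpr → RealExpr
  -- Query to the known distribution.
  prob    : IntExpr → RealExpr
  _⊞_ _⊟_ _⊠_ _⊘_ : RealExpr → RealExpr → RealExpr

data Test : Set where
  _≤ᵢ_ : IntExpr → IntExpr → Test
  _≤ᵣ_ : RealExpr → RealExpr → Test

data Stmt : Set where
  int[_]≔_    : IntExpr → IntExpr → Stmt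
  real[_]≔_   : IntExpr → RealExpr → Stmt
  -- Store a fresh independent sample from the unknown distribution.
  int[_]≔sample : IntExpr → Stmt
  -- Store a fresh fair random bit (the algorithm's own randomness).
  int[_]≔flip : IntExpr → Stmt
  branch      : Test → List Stmt → List Stmt → Stmt
  while       : Test → List Stmt → Stmt

-- Programs mention neither n, ε nor the distributions: one fixed program
-- receives n and ε as inputs.
Program : Set
Program = List Stmt

module _ {c ℓ₁ ℓ₂} (R : OrderedField c ℓ₁ ℓ₂) where
  open OrderedField R

  -- Elements of [n] = {1,…,n} are represented by 0,…,n-1.
  record Distribution (n : ℕ) : Set (c ⊔ ℓ₁ ⊔ ℓ₂) where
    field
      mass   : Fin n → Carrier
      nonNeg : ∀ i → 0# ≤ mass i
      total  : sum +-rawMonoid mass ≈ 1#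

  open Distribution public

  ‖_-_‖₁ : ∀ {n} → Distribution n → Distribution n → Carrier
  ‖ p - q ‖₁ = sum +-rawMonoid (λ i → ∣ mass p i - mass q i ∣)

  _≐_ : ∀ {n} → Distribution n → Distribution n → Set ℓ₁
  p ≐ q = ∀ i → mass p i ≈ mass q i

  record State : Set c where
    constructor ⟨_,_⟩
    field
      ints  : ℕ → ℕ
      reals : ℕ → Carrier

  open State public

  update : ∀ {a} {A : Set a} → (ℕ → A) → ℕ → A → ℕ → A
  update f a v b = if a ℕ.≡ᵇ b then v else f b

  setInt : State → ℕ → ℕ → State
  setInt s a v = ⟨ update (ints s) a v , reals s ⟩

  setReal : State → ℕ → Carrier → State
  setReal s a v = ⟨ ints s , update (reals s) a v ⟩

  initial : ℕ → Carrier → State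
  initial n ε = ⟨ update (λ _ → 0) 0 n , update (λ _ → 0#) 0 ε ⟩

  -- Queries outside the domain return 0#.
  query : ∀ {n} → Distribution n → ℕ → Carrier
  query {n} p a with a <? n
  ... | yes a<n = mass p (fromℕ< a<n)
  ... | no  _   = 0#

  evalInt : State → IntExpr → ℕ
  evalInt s (lit k)  = k
  evalInt s int[ e ] = ints s (evalInt s e)
  evalInt s (d ⊕ e)  = evalInt s d ℕ.+ evalInt s e
  evalInt s (d ⊖ e)  = evalInt s d ∸ evalInt s e

  evalReal : ∀ {n} → Distribution n → State → RealExpr → Carrier
  evalReal p s (cast e)  = fromℕ (evalInt s e)
  evalReal p s real[ e ] = reals s (evalInt s e)
  evalReal p s (prob e)  = query p (evalInt s e)
  evalReal p s (d ⊞ e)   = evalReal p s d + evalReal p s e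
  evalReal p s (d ⊟ e)   = evalReal p s d - evalReal p s e
  evalReal p s (d ⊠ e)   = evalReal p s d * evalReal p s e
  evalReal p s (d ⊘ e)   = evalReal p s d * evalReal p s e ⁻¹

  evalTest : ∀ {n} → Distribution n → State → Test → Bool
  evalTest p s (d ≤ᵢ e) = evalInt s d ℕ.≤ᵇ evalInt s e
  evalTest p s (d ≤ᵣ e) = ⌊ evalReal p s d ≤? evalReal p s e ⌋

  data Verdict : Set where
    accept reject : Verdict

  -- A halted computation accepts iff integer cell 0 is nonzero.
  verdict : State → Verdict
  verdict s = if ints s 0 ℕ.≡ᵇ 0 then reject else accept

  indicator : Verdict → Verdict → Carrier
  indicator accept accept = 1#
  indicator reject reject = 1#
  indicator accept reject = 0#
  indicator reject accept = 0#

  -- The probability that, started in state s with the statements P left to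
  -- execute, the computation halts within t steps with verdict v.  Every
  -- assignment, sample, coin flip and evaluation of a branch or loop test is
  -- one step: a fixed program contains finitely many expressions, so each
  -- step consists of boundedly many elementary operations.
  run : ∀ {n} → Distribution n → Distribution n →
        ℕ → Program → State → Verdict → Carrier
  run p q t       []      s v = indicator (verdict s) v
  run p q zero    (_ ∷ _) s v = 0#
  run p q (suc t) (int[ a ]≔ e ∷ P) s v =
    run p q t P (setInt s (evalInt s a) (evalInt s e)) v
  run p q (suc t) (real[ a ]≔ e ∷ P) s v =
    run p q t P (setReal s (evalInt s a) (evalReal p s e)) v
  run p q (suc t) (int[ a ]≔sample ∷ P) s v =
    sum +-rawMonoid λ i →
      mass q i * run p q t P (setInt s (evalInt s a) (toℕ i)) v
  run p q (suc t) (int[ a ]≔flip ∷ P) s v =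
    fromℕ 2 ⁻¹ * run p q t P (setInt s (evalInt s a) 0) v +
    fromℕ 2 ⁻¹ * run p q t P (setInt s (evalInt s a) 1) v
  run p q (suc t) (branch b P₁ P₂ ∷ P) s v =
    run p q t ((if evalTest p s b then P₁ else P₂) ++ P) s v
  run p q (suc t) (while b P₁ ∷ P) s v =
    run p q t (if evalTest p s b then P₁ ++ while b P₁ ∷ P else P) s v

  Pr[_,_,_,_halts-within_with-verdict_] :
    Program → ∀ {n} → Carrier → Distribution n → Distribution n →
    ℕ → Verdict → Carrier
  Pr[_,_,_,_halts-within_with-verdict_] P {n} ε p q t v =
    run p q t P (initial n ε) v

  -- Pr[ … halts-within t … ] is nondecreasing in t, and its supremum over t
  -- is the probability of the verdict.
  AcceptsWithProbability≥ RejectsWithProbability≥ :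
    Carrier → Program → ∀ {n} → Carrier →
    Distribution n → Distribution n → Set ℓ₂
  AcceptsWithProbability≥ r P ε p q =
    ∃[ t ] r ≤ Pr[ P , ε , p , q halts-within t with-verdict accept ]
  RejectsWithProbability≥ r P ε p q =
    ∃[ t ] r ≤ Pr[ P , ε , p , q halts-within t with-verdict reject ]

  ⅔ : Carrier
  ⅔ = fromℕ 2 * fromℕ 3 ⁻¹

  IsIdentityTester : Program → Set (c ⊔ ℓ₁ ⊔ ℓ₂)
  IsIdentityTester P =
    ∀ {n} → 1 ℕ.≤ n → ∀ ε → 0# < ε → (p q : Distribution n) →
      (p ≐ q → AcceptsWithProbability≥ ⅔ P ε p q) ×
      (ε ≤ ‖ p - q ‖₁ → RejectsWithProbability≥ ⅔ P ε p q)

  -- Worst case over p, q and over all outcomes of positive probability.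
  HasRunningTime : Program → (ℕ → Carrier → ℕ) → Set (c ⊔ ℓ₁ ⊔ ℓ₂)
  HasRunningTime P T =
    ∀ {n} → 1 ℕ.≤ n → ∀ ε → 0# < ε → (p q : Distribution n) →
      Pr[ P , ε , p , q halts-within T n ε with-verdict accept ] +
      Pr[ P , ε , p , q halts-within T n ε with-verdict reject ] ≈ 1#

  -- T(n,ε) = Õ(√n · poly(1/ε)):  T(n,ε) ≤ √n · C (1+log n)ᵏ (1+1/ε)ᵏ for some
  -- constants C and k.  Both sides are nonnegative and are compared through
  -- their squares, as the field need not contain √n.
  IsÕ[√n·poly[1/ε]] : (ℕ → Carrier → ℕ) → Set (c ⊔ ℓ₁ ⊔ ℓ₂)
  IsÕ[√n·poly[1/ε]] T =
    ∃[ C ] ∃[ k ] (∀ {n} → 1 ℕ.≤ n → ∀ ε → 0# < ε →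
      fromℕ (T n ε) ^ 2 ≤
      fromℕ n *
      (fromℕ C * fromℕ (1 ℕ.+ ⌊log₂ n ⌋) ^ k * (1# + ε ⁻¹) ^ k) ^ 2)

{-# OPTIONS --safe #-}
module Submission where

-- Let N be the least power of two with n ≤ N, and replace p and q by their
-- averages a and b with the uniform distribution on N points: b can be sampled
-- exactly with fair coins, and a ≥ 1/(2N).  Draw two batches xs and ys of m
-- samples of b each, with m ≈ √n/ε², and compute the statistic
-- Σ_{x ∈ xs, y ∈ ys} ([x = y]/a(x) − 1).  Its mean is m²χ with
-- χ = Σ (b − a)²/a, which is 0 if p = q and at least (ε/2)² if p and q are
-- ε-far.  No sum over the domain is needed, since the known term Σ a²/a is 1.
-- The statistic is bilinear in the two batches, so its variance follows from
-- applying the second moment of a sum of independent terms to ys given xs and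
-- then to xs; Chebyshev's inequality with the threshold m²ε²/8 finishes.  Time
-- is O(log n) per sample, since a memory table indexed by y holds the sum over
-- xs.  Every path takes the same number of steps, so the running time is exact.

open import Defs
open import Algebra.Solver.Ring.AlmostCommutativeRing
  using (fromCommutativeRing; _-Raw-AlmostCommutative⟶_)
open import Data.Bool.Base using (Bool; true; false; if_then_else_; T)
open import Data.Fin.Base using (Fin; zero; suc; toℕ)
open import Data.Fin.Properties using (toℕ<n; fromℕ<-toℕ)
open import Data.Integer.Base as ℤ using (ℤ; +_; -[1+_]; _◃_; +-*-rawRing)
open import Data.Integer.Properties as ℤₚ using ([1+m]⊖[1+n]≡m⊖n)
open import Data.List.Base using (List; []; _∷_; length; _++_)
open import Data.Maybe.Base using (map)
open import Data.Nat.Base as ℕ using (ℕ; zero; suc; z≤n; s≤s)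
open import Data.Nat.Logarithm using (⌊log₂_⌋; ⌊log₂⌋-mono-≤; ⌊log₂[2^n]⌋≡n)
import Data.Nat.Properties as ℕₚ
open import Data.Nat.Tactic.RingSolver using (solve-∀)
open import Data.Product.Base using (Σ-syntax; _×_; _,_; proj₁; proj₂)
open import Data.Sign.Base as Sign using (Sign)
open import Data.Sum.Base using (_⊎_; inj₁; inj₂)
open import Data.Unit.Base using (tt)
open import Level using (_⊔_)
open import Relation.Binary.Bundles using (Poset)
open import Relation.Binary.Consequences using (dec⇒weaklyDec)
open import Relation.Binary.PropositionalEquality as ≡ using (_≡_)
open import Relation.Binary.Structures using (IsDecTotalOrder)
open import Relation.Nullary using (¬_; yes; no; contradiction)
open import Relation.Nullary.Decidable.Core using (⌊_⌋)

-- Two constraints shape the proof. Neither the field nor the machine provides square roots. So `m`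
-- is never computed: the first loop draws until `m²ε⁴` reaches the order of `n`. In the analysis,
-- the natural bound √(Mχ) on the relative deviation δ = b/a - 1 is replaced by a number `D` whose
-- square dominates `Mχ`. Moreover, the running time must hold with probability one, which excludes
-- rejection sampling; padding the domain to a power of two lets a uniform point be assembled from a
-- fixed number of fair bits.
--
-- Averaging with the uniform distribution halves the ℓ₁-distance and buys 1/a ≤ M = 2N ≤ 4n. This
-- one bound controls both terms of the variance 2m³B + m²A: the second moment `A` of a single pair
-- is at most M(1 + χ), and the second moment `B` of δ is at most χ(1 + D). In the far case D = mχ/κ
-- makes the squared mean m⁴χ² equal to κ²m²D², and every variance term is at most a multiple of
-- κm²D² or m²D², so the error probability is of order 1/κ.

module FieldProperties {c ℓ₁ ℓ₂} (R : OrderedField c ℓ₁ ℓ₂) where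

  open OrderedField R hiding (zero)

  open import Algebra.Properties.Ring ring public
    using (-‿distribˡ-*; -‿distribʳ-*; -0#≈0#; -‿involutive; -‿+-comm)
  open import Algebra.Properties.Semiring.Mult semiring public
    using (×-homo-+; ×1-homo-*)
  module DTO = IsDecTotalOrder isDecTotalOrder

  private
    module SetoidReasoning where
      open import Relation.Binary.Reasoning.Setoid setoid public

  -- Images of naturals and integers in the field, and a ring solver over them.

  fromℕ-+ : ∀ m n → fromℕ (m ℕ.+ n) ≈ fromℕ m + fromℕ n
  fromℕ-+ = ×-homo-+ 1#

  fromℕ-* : ∀ m n → fromℕ (m ℕ.* n) ≈ fromℕ m * fromℕ n
  fromℕ-* = ×1-homo-*

  fromℕ-1 : fromℕ 1 ≈ 1#
  fromℕ-1 = +-identityʳ 1#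

  -- The library's ring solver decides only identities between coefficients
  -- that compute, so the coefficients are taken in ℤ and mapped into R.
  private
    fromℤ : ℤ → Carrier
    fromℤ (+ n)    = fromℕ n
    fromℤ -[1+ n ] = - fromℕ (suc n)

    fromℤ-⊖ : ∀ m n → fromℤ (m ℤ.⊖ n) ≈ fromℕ m - fromℕ n
    fromℤ-⊖ m zero = sym (trans (+-congˡ -0#≈0#) (+-identityʳ _))
    fromℤ-⊖ zero (suc n) = sym (+-identityˡ _)
    fromℤ-⊖ (suc m) (suc n) = begin
      fromℤ (suc m ℤ.⊖ suc n)                  ≡⟨ ≡.cong fromℤ ([1+m]⊖[1+n]≡m⊖n m n) ⟩
      fromℤ (m ℤ.⊖ n)                          ≈⟨ fromℤ-⊖ m n ⟩
      fromℕ m - fromℕ n                      ≈⟨ +-congʳ (+-identityˡ _) ⟨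
      (0# + fromℕ m) - fromℕ n               ≈⟨ +-congʳ (+-congʳ (-‿inverseʳ 1#)) ⟨
      ((1# - 1#) + fromℕ m) - fromℕ n        ≈⟨ +-congʳ (+-assoc _ _ _) ⟩
      (1# + (- 1# + fromℕ m)) - fromℕ n      ≈⟨ +-congʳ (+-congˡ (+-comm _ _)) ⟩
      (1# + (fromℕ m - 1#)) - fromℕ n        ≈⟨ +-congʳ (+-assoc _ _ _) ⟨
      ((1# + fromℕ m) - 1#) - fromℕ n        ≈⟨ +-assoc _ _ _ ⟩
      (1# + fromℕ m) + (- 1# - fromℕ n)      ≈⟨ +-congˡ (-‿+-comm 1# (fromℕ n)) ⟩
      fromℕ (suc m) - fromℕ (suc n)          ∎
      where open SetoidReasoning

    fromℤ-+ : ∀ i j → fromℤ (i ℤ.+ j) ≈ fromℤ i + fromℤ j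
    fromℤ-+ (+ m)    (+ n)    = fromℕ-+ m n
    fromℤ-+ (+ m)    -[1+ n ] = fromℤ-⊖ m (suc n)
    fromℤ-+ -[1+ m ] (+ n)    = trans (fromℤ-⊖ n (suc m)) (+-comm _ _)
    fromℤ-+ -[1+ m ] -[1+ n ] = begin
      - fromℕ (suc (suc (m ℕ.+ n)))        ≡⟨ ≡.cong (λ k → - fromℕ k) (ℕₚ.+-suc (suc m) n) ⟨
      - fromℕ (suc m ℕ.+ suc n)            ≈⟨ -‿cong (fromℕ-+ (suc m) (suc n)) ⟩
      - (fromℕ (suc m) + fromℕ (suc n))    ≈⟨ -‿+-comm _ _ ⟨
      - fromℕ (suc m) - fromℕ (suc n)      ∎
      where open SetoidReasoning

    fromℤ-◃⁺ : ∀ n → fromℤ (Sign.+ ◃ n) ≈ fromℕ n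
    fromℤ-◃⁺ zero    = refl
    fromℤ-◃⁺ (suc n) = refl

    fromℤ-◃⁻ : ∀ n → fromℤ (Sign.- ◃ n) ≈ - fromℕ n
    fromℤ-◃⁻ zero    = sym -0#≈0#
    fromℤ-◃⁻ (suc n) = refl

    fromℤ-* : ∀ i j → fromℤ (i ℤ.* j) ≈ fromℤ i * fromℤ j
    fromℤ-* (+ m) (+ n) = trans (fromℤ-◃⁺ (m ℕ.* n)) (fromℕ-* m n)
    fromℤ-* (+ m) -[1+ n ] =
      trans (fromℤ-◃⁻ (m ℕ.* suc n)) (trans (-‿cong (fromℕ-* m (suc n))) (-‿distribʳ-* _ _))
    fromℤ-* -[1+ m ] (+ n) =
      trans (fromℤ-◃⁻ (suc m ℕ.* n)) (trans (-‿cong (fromℕ-* (suc m) n)) (-‿distribˡ-* _ _))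
    fromℤ-* -[1+ m ] -[1+ n ] = begin
      fromℤ (Sign.+ ◃ (suc m ℕ.* suc n))         ≈⟨ fromℤ-◃⁺ (suc m ℕ.* suc n) ⟩
      fromℕ (suc m ℕ.* suc n)                    ≈⟨ fromℕ-* (suc m) (suc n) ⟩
      fromℕ (suc m) * fromℕ (suc n)              ≈⟨ -‿involutive _ ⟨
      - - (fromℕ (suc m) * fromℕ (suc n))        ≈⟨ -‿cong (-‿distribˡ-* _ _) ⟩
      - (- fromℕ (suc m) * fromℕ (suc n))        ≈⟨ -‿distribʳ-* _ _ ⟩
      - fromℕ (suc m) * - fromℕ (suc n)          ∎
      where open SetoidReasoning

    fromℤ-neg : ∀ i → fromℤ (ℤ.- i) ≈ - fromℤ i
    fromℤ-neg (+ zero)  = sym -0#≈0#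
    fromℤ-neg (+ suc n) = refl
    fromℤ-neg -[1+ n ]  = sym (-‿involutive _)

    ℤ⟶R : +-*-rawRing -Raw-AlmostCommutative⟶ fromCommutativeRing commutativeRing
    ℤ⟶R = record
      { ⟦_⟧    = fromℤ
      ; +-homo = fromℤ-+
      ; *-homo = fromℤ-*
      ; -‿homo = fromℤ-neg
      ; 0-homo = refl
      ; 1-homo = fromℕ-1
      }

  open import Algebra.Solver.Ring +-*-rawRing (fromCommutativeRing commutativeRing) ℤ⟶R
    (λ i j → map (λ i≡j → reflexive (≡.cong fromℤ i≡j)) (dec⇒weaklyDec ℤₚ._≟_ i j)) public
    using (Polynomial; solve; con; _:^_; _:+_; _:*_; _:-_; :-_; _:=_)

  -- con (+ 1) denotes fromℕ 1, that is 1# + 0#.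
  :1 : ∀ {n} → Polynomial n
  :1 = con (+ 0) :^ 0

  :n : ℕ → ∀ {n} → Polynomial n
  :n k = con (+ k)

  :0 :2 :4 : ∀ {n} → Polynomial n
  :0 = :n 0
  :2 = :n 2
  :4 = :n 4

  -- Order, inverses and absolute values in an ordered field.

  open DTO public using (antisym; _≟_)
    renaming (refl to ≤-refl; trans to ≤-trans; reflexive to ≤-reflexive; total to ≤-total)

  poset : Poset c ℓ₁ ℓ₂
  poset = record { isPartialOrder = DTO.isPartialOrder }

  module ≤-Reasoning where
    open import Relation.Binary.Reasoning.PartialOrder poset public

  ≤-respˡ : ∀ {x y z} → x ≈ y → x ≤ z → y ≤ z
  ≤-respˡ x≈y = ≤-trans (≤-reflexive (sym x≈y))

  ≤-respʳ : ∀ {x y z} → y ≈ z → x ≤ y → x ≤ z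
  ≤-respʳ y≈z x≤y = ≤-trans x≤y (≤-reflexive y≈z)

  ≰⇒≥ : ∀ {x y} → ¬ (x ≤ y) → y ≤ x
  ≰⇒≥ {x} {y} x≰y with ≤-total x y
  ... | inj₁ x≤y = contradiction x≤y x≰y
  ... | inj₂ y≤x = y≤x

  +-mono-≤ : ∀ {w x y z} → w ≤ x → y ≤ z → w + y ≤ x + z
  +-mono-≤ {w} {x} {y} {z} w≤x y≤z = ≤-trans (+-monoʳ-≤ w y≤z)
    (≤-respˡ (+-comm z w) (≤-respʳ (+-comm z x) (+-monoʳ-≤ z w≤x)))

  +-nonNeg : ∀ {x y} → 0# ≤ x → 0# ≤ y → 0# ≤ x + y
  +-nonNeg 0≤x 0≤y = ≤-respˡ (+-identityˡ 0#) (+-mono-≤ 0≤x 0≤y)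

  ≤⇒0≤y-x : ∀ {x y} → x ≤ y → 0# ≤ y - x
  ≤⇒0≤y-x {x} {y} x≤y =
    ≤-respˡ (-‿inverseˡ x) (≤-respʳ (+-comm (- x) y) (+-monoʳ-≤ (- x) x≤y))

  ≤-by : ∀ {x y d} → 0# ≤ d → y ≈ x + d → x ≤ y
  ≤-by {x} 0≤d y≈x+d =
    ≤-respʳ (sym y≈x+d) (≤-respˡ (+-identityʳ x) (+-monoʳ-≤ x 0≤d))

  neg-mono-≤ : ∀ {x y} → x ≤ y → - y ≤ - x
  neg-mono-≤ {x} {y} x≤y =
    ≤-by (≤⇒0≤y-x x≤y) (solve 2 (λ x y → :- x := :- y :+ (y :- x)) refl x y)

  *-monoˡ-≤ : ∀ {x y z} → 0# ≤ x → y ≤ z → x * y ≤ x * z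
  *-monoˡ-≤ {x} {y} {z} 0≤x y≤z = ≤-by (*-nonNeg 0≤x (≤⇒0≤y-x y≤z))
    (solve 3 (λ x y z → x :* z := x :* y :+ x :* (z :- y)) refl x y z)

  *-monoʳ-≤ : ∀ {x y z} → 0# ≤ x → y ≤ z → y * x ≤ z * x
  *-monoʳ-≤ 0≤x y≤z = ≤-respˡ (*-comm _ _) (≤-respʳ (*-comm _ _) (*-monoˡ-≤ 0≤x y≤z))

  *-mono-≤ : ∀ {w x y z} → 0# ≤ x → 0# ≤ y → w ≤ x → y ≤ z → w * y ≤ x * z
  *-mono-≤ 0≤x 0≤y w≤x y≤z = ≤-trans (*-monoʳ-≤ 0≤y w≤x) (*-monoˡ-≤ 0≤x y≤z)

  square-nonNeg : ∀ x → 0# ≤ x * x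
  square-nonNeg x with ≤-total 0# x
  ... | inj₁ 0≤x = *-nonNeg 0≤x 0≤x
  ... | inj₂ x≤0 = ≤-respʳ (solve 1 (λ x → (:- x) :* (:- x) := x :* x) refl x)
                     (*-nonNeg 0≤-x 0≤-x)
    where
    0≤-x = ≤-respˡ -0#≈0# (neg-mono-≤ x≤0)

  0≤1 : 0# ≤ 1#
  0≤1 = ≤-respʳ (*-identityˡ 1#) (square-nonNeg 1#)

  fromℕ-nonNeg : ∀ n → 0# ≤ fromℕ n
  fromℕ-nonNeg zero    = ≤-refl
  fromℕ-nonNeg (suc n) = +-nonNeg 0≤1 (fromℕ-nonNeg n)

  fromℕ-mono-≤ : ∀ {m n} → m ℕ.≤ n → fromℕ m ≤ fromℕ n
  fromℕ-mono-≤ {n = n} z≤n = fromℕ-nonNeg n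
  fromℕ-mono-≤ (s≤s m≤n)   = +-monoʳ-≤ 1# (fromℕ-mono-≤ m≤n)

  1≤fromℕ : ∀ {n} → 1 ℕ.≤ n → 1# ≤ fromℕ n
  1≤fromℕ 1≤n = ≤-respˡ fromℕ-1 (fromℕ-mono-≤ 1≤n)

  >⇒≉ : ∀ {x} → 0# < x → ¬ (x ≈ 0#)
  >⇒≉ (_ , 0≉x) x≈0 = 0≉x (sym x≈0)

  <-≤-trans : ∀ {x y} → 0# < x → x ≤ y → 0# < y
  <-≤-trans (0≤x , 0≉x) x≤y =
    ≤-trans 0≤x x≤y , λ 0≈y → 0≉x (antisym 0≤x (≤-respʳ (sym 0≈y) x≤y))

  0<1 : 0# < 1#
  0<1 = 0≤1 , 0≉1

  fromℕ-pos : ∀ {n} → 1 ℕ.≤ n → 0# < fromℕ n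
  fromℕ-pos 1≤n = <-≤-trans 0<1 (1≤fromℕ 1≤n)

  -- The inverse of `x` equals its own square times `x`, a product of nonnegative factors.
  ⁻¹-nonNeg : ∀ {x} → 0# < x → 0# ≤ x ⁻¹
  ⁻¹-nonNeg {x} 0<x = ≤-respʳ
    (trans (*-assoc _ _ _) (trans (*-congˡ (trans (*-comm _ _) (*-inverseʳ x (>⇒≉ 0<x)))) (*-identityʳ _)))
    (≤-respʳ (solve 2 (λ x y → (y :* y) :* x := y :* y :* x) refl x (x ⁻¹))
       (*-nonNeg (square-nonNeg (x ⁻¹)) (proj₁ 0<x)))

  *-cancelˡ-≈ : ∀ {x y z} → ¬ (x ≈ 0#) → x * y ≈ x * z → y ≈ z
  *-cancelˡ-≈ {x} {y} {z} x≉0 xy≈xz = begin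
    y                 ≈⟨ cancel y ⟨
    x ⁻¹ * (x * y)    ≈⟨ *-congˡ xy≈xz ⟩
    x ⁻¹ * (x * z)    ≈⟨ cancel z ⟩
    z                 ∎
    where
    open SetoidReasoning
    cancel : ∀ t → x ⁻¹ * (x * t) ≈ t
    cancel t = begin
      x ⁻¹ * (x * t)    ≈⟨ solve 3 (λ x i t → i :* (x :* t) := (x :* i) :* t) refl x (x ⁻¹) t ⟩
      (x * x ⁻¹) * t    ≈⟨ *-congʳ (*-inverseʳ x x≉0) ⟩
      1# * t            ≈⟨ *-identityˡ t ⟩
      t                 ∎

  *-pos : ∀ {x y} → 0# < x → 0# < y → 0# < x * y
  *-pos {x} (0≤x , 0≉x) (0≤y , 0≉y) = *-nonNeg 0≤x 0≤y , λ 0≈xy →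
    0≉y (*-cancelˡ-≈ (λ x≈0 → 0≉x (sym x≈0)) (trans (zeroʳ x) 0≈xy))

  *-cancelˡ-≤ : ∀ {x y z} → 0# < x → x * y ≤ x * z → y ≤ z
  *-cancelˡ-≤ {x} {y} {z} 0<x xy≤xz with ≤-total y z
  ... | inj₁ y≤z = y≤z
  ... | inj₂ z≤y = ≤-reflexive
    (*-cancelˡ-≈ (>⇒≉ 0<x) (antisym xy≤xz (*-monoˡ-≤ (proj₁ 0<x) z≤y)))

  -- Stands in for monotonicity of the square root. If `y ≤ x` and `x` is nonzero, then
  -- `x * x ≤ y * y ≤ x * y`, and `x` cancels.
  square-cancel-≤ : ∀ {x y} → 0# ≤ y → x * x ≤ y * y → x ≤ y
  square-cancel-≤ {x} {y} 0≤y xx≤yy with ≤-total x y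
  ... | inj₁ x≤y = x≤y
  ... | inj₂ y≤x with 0# ≟ x
  ...   | yes 0≈x = ≤-respˡ 0≈x 0≤y
  ...   | no  0≉x = *-cancelˡ-≤ (≤-trans 0≤y y≤x , 0≉x)
            (≤-trans xx≤yy (*-monoʳ-≤ 0≤y y≤x))

  ∣∣-cases : ∀ x → (0# ≤ x × ∣ x ∣ ≈ x) ⊎ (x ≤ 0# × ∣ x ∣ ≈ - x)
  ∣∣-cases x with 0# ≤? x
  ... | yes 0≤x = inj₁ (0≤x , refl)
  ... | no  0≰x = inj₂ (≰⇒≥ 0≰x , refl)

  ∣∣-square : ∀ x → ∣ x ∣ * ∣ x ∣ ≈ x * x
  ∣∣-square x with ∣∣-cases x
  ... | inj₁ (_ , ∣x∣≈x)  = *-cong ∣x∣≈x ∣x∣≈x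
  ... | inj₂ (_ , ∣x∣≈-x) = trans (*-cong ∣x∣≈-x ∣x∣≈-x)
                              (solve 1 (λ x → (:- x) :* (:- x) := x :* x) refl x)

  ∣x-y∣≤x+y : ∀ {x y} → 0# ≤ x → 0# ≤ y → ∣ x - y ∣ ≤ x + y
  ∣x-y∣≤x+y {x} {y} 0≤x 0≤y with ∣∣-cases (x - y)
  ... | inj₁ (_ , ∣∣≈) = ≤-respˡ (sym ∣∣≈) (≤-by (+-nonNeg 0≤y 0≤y)
    (solve 2 (λ x y → x :+ y := (x :- y) :+ (y :+ y)) refl x y))
  ... | inj₂ (_ , ∣∣≈) = ≤-respˡ (sym ∣∣≈) (≤-by (+-nonNeg 0≤x 0≤x)
    (solve 2 (λ x y → x :+ y := (:- (x :- y)) :+ (x :+ x)) refl x y))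

  ∣∣-nonNeg : ∀ x → 0# ≤ ∣ x ∣
  ∣∣-nonNeg x with ∣∣-cases x
  ... | inj₁ (0≤x , ∣x∣≈x)  = ≤-respʳ (sym ∣x∣≈x) 0≤x
  ... | inj₂ (x≤0 , ∣x∣≈-x) = ≤-respʳ (sym ∣x∣≈-x) (≤-respˡ -0#≈0# (neg-mono-≤ x≤0))

  ∣∣-mono-square : ∀ {x y} → x * x ≤ y * y → ∣ x ∣ ≤ ∣ y ∣
  ∣∣-mono-square {x} {y} xx≤yy = square-cancel-≤ (∣∣-nonNeg y)
    (≤-respˡ (sym (∣∣-square x)) (≤-respʳ (sym (∣∣-square y)) xx≤yy))

  -- The absolute value branches on a decision, so congruence is not immediate; comparing squares
  -- avoids matching up two decisions.
  ∣∣-cong : ∀ {x y} → x ≈ y → ∣ x ∣ ≈ ∣ y ∣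
  ∣∣-cong x≈y = antisym (∣∣-mono-square (≤-reflexive (*-cong x≈y x≈y)))
    (∣∣-mono-square (≤-reflexive (*-cong (sym x≈y) (sym x≈y))))

-- Finite sums over initial segments of the naturals.

module Sums {c ℓ₁ ℓ₂} (R : OrderedField c ℓ₁ ℓ₂) where

  open OrderedField R hiding (zero)
  open FieldProperties R
  open ≤-Reasoning
  open import Algebra.Properties.Semiring.Sum semiring
    using (sum; sum-cong-≋; ∑-distrib-+; ∑-comm; *-distribˡ-sum; sum-replicate-zero)

  sum-mono-≤ : ∀ {n} {f g : Fin n → Carrier} → (∀ i → f i ≤ g i) → sum f ≤ sum g
  sum-mono-≤ {zero}  f≤g = ≤-refl
  sum-mono-≤ {suc n} f≤g = +-mono-≤ (f≤g zero) (sum-mono-≤ (λ i → f≤g (suc i)))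

  opaque
    -- Summands are functions on the naturals, so that points of the original domain, points of the
    -- padded domain and memory addresses share one type.
    ∑< : ℕ → (ℕ → Carrier) → Carrier
    ∑< N f = sum {N} (λ i → f (toℕ i))

    ∑<-cong : ∀ N {f g} → (∀ i → i ℕ.< N → f i ≈ g i) → ∑< N f ≈ ∑< N g
    ∑<-cong N f≈g = sum-cong-≋ (λ i → f≈g (toℕ i) (toℕ<n i))

    ∑<-mono : ∀ N {f g} → (∀ i → i ℕ.< N → f i ≤ g i) → ∑< N f ≤ ∑< N g
    ∑<-mono N f≤g = sum-mono-≤ (λ i → f≤g (toℕ i) (toℕ<n i))

    ∑<-+ : ∀ N f g → ∑< N (λ i → f i + g i) ≈ ∑< N f + ∑< N g
    ∑<-+ N f g = ∑-distrib-+ {N} (λ i → f (toℕ i)) (λ i → g (toℕ i))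

    ∑<-* : ∀ N x f → ∑< N (λ i → x * f i) ≈ x * ∑< N f
    ∑<-* N x f = sym (*-distribˡ-sum {N} x (λ i → f (toℕ i)))

    ∑<-comm : ∀ M N (f : ℕ → ℕ → Carrier) →
              ∑< M (λ i → ∑< N (f i)) ≈ ∑< N (λ j → ∑< M (λ i → f i j))
    ∑<-comm M N f = ∑-comm {M} {N} (λ i j → f (toℕ i) (toℕ j))

    ∑<-0 : ∀ N {f} → (∀ i → i ℕ.< N → f i ≈ 0#) → ∑< N f ≈ 0#
    ∑<-0 N f≈0 = trans (∑<-cong N f≈0) (sum-replicate-zero N)

    ∑<-const : ∀ N x → ∑< N (λ _ → x) ≈ fromℕ N * x
    ∑<-const zero    x = sym (zeroˡ x)
    ∑<-const (suc N) x = begin-equality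
      x + ∑< N (λ _ → x)      ≈⟨ +-congˡ (∑<-const N x) ⟩
      x + fromℕ N * x         ≈⟨ solve 2 (λ x n → x :+ n :* x := (:1 :+ n) :* x) refl x (fromℕ N) ⟩
      fromℕ (suc N) * x       ∎

    ∑<-split : ∀ M N f → ∑< (M ℕ.+ N) f ≈ ∑< M f + ∑< N (λ i → f (M ℕ.+ i))
    ∑<-split zero    N f = sym (+-identityˡ _)
    ∑<-split (suc M) N f =
      trans (+-congˡ (∑<-split M N (λ i → f (suc i)))) (sym (+-assoc _ _ _))

    ∑<-extend : ∀ {M N} f → M ℕ.≤ N → (∀ i → M ℕ.≤ i → f i ≈ 0#) → ∑< M f ≈ ∑< N f
    ∑<-extend {N = N} f z≤n f≈0 = sym (∑<-0 N (λ i _ → f≈0 i z≤n))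
    ∑<-extend f (s≤s M≤N) f≈0 =
      +-congˡ (∑<-extend (λ i → f (suc i)) M≤N (λ i M≤i → f≈0 (suc i) (s≤s M≤i)))

    ∑<-delta : ∀ N (f : ℕ → Carrier) x → x ℕ.< N → ∑< N (λ i → if x ℕ.≡ᵇ i then f i else 0#) ≈ f x
    ∑<-delta (suc N) f zero    _         = trans (+-congˡ (∑<-0 N λ _ _ → refl)) (+-identityʳ _)
    ∑<-delta (suc N) f (suc x) (s≤s x<N) =
      trans (+-identityˡ _) (∑<-delta N (λ i → f (suc i)) x x<N)

  ∑<-nonNeg : ∀ N {f} → (∀ i → i ℕ.< N → 0# ≤ f i) → 0# ≤ ∑< N f
  ∑<-nonNeg N 0≤f = ≤-respˡ (∑<-0 N (λ _ _ → refl)) (∑<-mono N 0≤f)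

  term≤∑< : ∀ N (f : ℕ → Carrier) x → (∀ i → i ℕ.< N → 0# ≤ f i) → x ℕ.< N → f x ≤ ∑< N f
  term≤∑< N f x 0≤f x<N = ≤-respˡ (∑<-delta N f x x<N) (∑<-mono N δ≤f)
    where
    δ≤f : ∀ i → i ℕ.< N → (if x ℕ.≡ᵇ i then f i else 0#) ≤ f i
    δ≤f i i<N with x ℕ.≡ᵇ i
    ... | true  = ≤-refl
    ... | false = 0≤f i i<N

  ∑ᴸ : (ℕ → Carrier) → List ℕ → Carrier
  ∑ᴸ f []       = 0#
  ∑ᴸ f (x ∷ xs) = f x + ∑ᴸ f xs

-- Expectations over independent samples, and moments of sums.

module Expectation {c ℓ₁ ℓ₂} (R : OrderedField c ℓ₁ ℓ₂)
  (N : ℕ) (b : ℕ → OrderedField.Carrier R) where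

  open OrderedField R hiding (zero)
  open FieldProperties R
  open Sums R
  open ≤-Reasoning

  opaque
    𝔼 : (ℕ → Carrier) → Carrier
    𝔼 f = ∑< N (λ i → b i * f i)

  -- The list holds the samples drawn so far, newest first, so that the recursion follows a sampling
  -- loop round by round.
  𝔼^ : ℕ → (List ℕ → Carrier) → List ℕ → Carrier
  𝔼^ zero    F xs = F xs
  𝔼^ (suc m) F xs = 𝔼 (λ i → 𝔼^ m F (i ∷ xs))

  opaque
    unfolding 𝔼

    𝔼-cong : ∀ {f g} → (∀ i → i ℕ.< N → f i ≈ g i) → 𝔼 f ≈ 𝔼 g
    𝔼-cong f≈g = ∑<-cong N (λ i i<N → *-congˡ (f≈g i i<N))

    𝔼-+ : ∀ f g → 𝔼 (λ i → f i + g i) ≈ 𝔼 f + 𝔼 g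
    𝔼-+ f g = trans (∑<-cong N (λ i _ → distribˡ (b i) (f i) (g i))) (∑<-+ N _ _)

    𝔼-* : ∀ x f → 𝔼 (λ i → x * f i) ≈ x * 𝔼 f
    𝔼-* x f = trans
      (∑<-cong N (λ i _ → solve 3 (λ b x f → b :* (x :* f) := x :* (b :* f)) refl (b i) x (f i)))
      (∑<-* N x _)

    𝔼-comm : ∀ (f : ℕ → ℕ → Carrier) → 𝔼 (λ i → 𝔼 (f i)) ≈ 𝔼 (λ j → 𝔼 (λ i → f i j))
    𝔼-comm f = begin-equality
      𝔼 (λ i → 𝔼 (f i))                                    ≈⟨ ∑<-cong N (λ i _ → ∑<-* N (b i) _) ⟨
      ∑< N (λ i → ∑< N (λ j → b i * (b j * f i j)))        ≈⟨ ∑<-comm N N _ ⟩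
      ∑< N (λ j → ∑< N (λ i → b i * (b j * f i j)))        ≈⟨ ∑<-cong N (λ j _ → 𝔼-* (b j) (λ i → f i j)) ⟩
      𝔼 (λ j → 𝔼 (λ i → f i j))                            ∎

  𝔼^-cong : ∀ m {F G} → (∀ xs → F xs ≈ G xs) → ∀ xs → 𝔼^ m F xs ≈ 𝔼^ m G xs
  𝔼^-cong zero    F≈G xs = F≈G xs
  𝔼^-cong (suc m) F≈G xs = 𝔼-cong (λ i _ → 𝔼^-cong m F≈G (i ∷ xs))

  𝔼^-+ : ∀ m F G xs → 𝔼^ m (λ xs → F xs + G xs) xs ≈ 𝔼^ m F xs + 𝔼^ m G xs
  𝔼^-+ zero    F G xs = refl
  𝔼^-+ (suc m) F G xs = trans (𝔼-cong (λ i _ → 𝔼^-+ m F G (i ∷ xs))) (𝔼-+ _ _)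

  𝔼^-* : ∀ m x F xs → 𝔼^ m (λ xs → x * F xs) xs ≈ x * 𝔼^ m F xs
  𝔼^-* zero    x F xs = refl
  𝔼^-* (suc m) x F xs = trans (𝔼-cong (λ i _ → 𝔼^-* m x F (i ∷ xs))) (𝔼-* _ _)

  𝔼^-𝔼-comm : ∀ m (F : ℕ → List ℕ → Carrier) xs →
              𝔼^ m (λ xs → 𝔼 (λ y → F y xs)) xs ≈ 𝔼 (λ y → 𝔼^ m (F y) xs)
  𝔼^-𝔼-comm zero    F xs = refl
  𝔼^-𝔼-comm (suc m) F xs =
    trans (𝔼-cong (λ i _ → 𝔼^-𝔼-comm m F (i ∷ xs))) (𝔼-comm _)

  module _ (∑b≈1 : ∑< N b ≈ 1#) where

    opaque
      unfolding 𝔼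

      𝔼-const : ∀ x → 𝔼 (λ _ → x) ≈ x
      𝔼-const x = begin-equality
        ∑< N (λ i → b i * x)    ≈⟨ ∑<-cong N (λ i _ → *-comm (b i) x) ⟩
        ∑< N (λ i → x * b i)    ≈⟨ ∑<-* N x b ⟩
        x * ∑< N b              ≈⟨ *-congˡ ∑b≈1 ⟩
        x * 1#                  ≈⟨ *-identityʳ x ⟩
        x                       ∎

    𝔼^-const : ∀ m x xs → 𝔼^ m (λ _ → x) xs ≈ x
    𝔼^-const zero    x xs = refl
    𝔼^-const (suc m) x xs = trans (𝔼-cong (λ i _ → 𝔼^-const m x (i ∷ xs))) (𝔼-const x)

    mean : ∀ m f xs → 𝔼^ m (∑ᴸ f) xs ≈ ∑ᴸ f xs + fromℕ m * 𝔼 f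
    mean zero    f xs = solve 2 (λ s μ → s := s :+ :0 :* μ) refl (∑ᴸ f xs) (𝔼 f)
    mean (suc m) f xs = begin-equality
      𝔼 (λ i → 𝔼^ m (∑ᴸ f) (i ∷ xs))           ≈⟨ 𝔼-cong (λ i _ → mean m f (i ∷ xs)) ⟩
      𝔼 (λ i → f i + s + M * μ)                ≈⟨ 𝔼-cong (λ i _ → +-assoc (f i) s (M * μ)) ⟩
      𝔼 (λ i → f i + (s + M * μ))              ≈⟨ 𝔼-+ f _ ⟩
      μ + 𝔼 (λ i → s + M * μ)                  ≈⟨ +-congˡ (𝔼-const _) ⟩
      μ + (s + M * μ)                          ≈⟨ solve 3 (λ s μ m → μ :+ (s :+ m :* μ) := s :+ (:1 :+ m) :* μ) refl s μ M ⟩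
      s + fromℕ (suc m) * μ                    ∎
      where
      s = ∑ᴸ f xs
      μ = 𝔼 f
      M = fromℕ m

    -- Squared mean plus the variance of `m` independent terms; the part already accumulated shifts
    -- the mean only. In the induction the mean for the remaining draws is affine in the new value
    -- `f i`, so expanding its square leaves the second moment of `f`, a cross term linear in `f`,
    -- and a constant.
    second-moment : ∀ m f xs → 𝔼^ m (λ xs → ∑ᴸ f xs * ∑ᴸ f xs) xs ≈
      (∑ᴸ f xs + fromℕ m * 𝔼 f) * (∑ᴸ f xs + fromℕ m * 𝔼 f) +
      fromℕ m * (𝔼 (λ i → f i * f i) - 𝔼 f * 𝔼 f)
    second-moment zero f xs =
      solve 3 (λ s μ σ → s :* s := (s :+ :0 :* μ) :* (s :+ :0 :* μ) :+ :0 :* (σ :- μ :* μ))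
        refl (∑ᴸ f xs) (𝔼 f) (𝔼 (λ i → f i * f i))
    second-moment (suc m) f xs = begin-equality
      𝔼 (λ i → 𝔼^ m (λ xs → ∑ᴸ f xs * ∑ᴸ f xs) (i ∷ xs))
        ≈⟨ 𝔼-cong (λ i _ → trans (second-moment m f (i ∷ xs))
             (solve 4 (λ f s t v → (f :+ s :+ t) :* (f :+ s :+ t) :+ v :=
                (f :* f :+ (:2 :* (s :+ t)) :* f) :+ ((s :+ t) :* (s :+ t) :+ v))
                refl (f i) s (M * μ) (M * (σ - μ * μ)))) ⟩
      𝔼 (λ i → (f i * f i + (fromℕ 2 * (s + M * μ)) * f i) + ((s + M * μ) * (s + M * μ) + M * (σ - μ * μ)))
        ≈⟨ trans (𝔼-+ _ _) (+-cong (𝔼-+ _ _) (𝔼-const _)) ⟩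
      (σ + 𝔼 (λ i → (fromℕ 2 * (s + M * μ)) * f i)) + ((s + M * μ) * (s + M * μ) + M * (σ - μ * μ))
        ≈⟨ +-congʳ (+-congˡ (𝔼-* _ f)) ⟩
      (σ + (fromℕ 2 * (s + M * μ)) * μ) + ((s + M * μ) * (s + M * μ) + M * (σ - μ * μ))
        ≈⟨ solve 4 (λ s m μ σ →
             (σ :+ (:2 :* (s :+ m :* μ)) :* μ) :+ ((s :+ m :* μ) :* (s :+ m :* μ) :+ m :* (σ :- μ :* μ)) :=
             (s :+ (:1 :+ m) :* μ) :* (s :+ (:1 :+ m) :* μ) :+ (:1 :+ m) :* (σ :- μ :* μ)) refl s M μ σ ⟩
      (s + fromℕ (suc m) * μ) * (s + fromℕ (suc m) * μ) + fromℕ (suc m) * (σ - μ * μ) ∎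
      where
      s = ∑ᴸ f xs
      μ = 𝔼 f
      σ = 𝔼 (λ i → f i * f i)
      M = fromℕ m

    second-moment-≤ : ∀ m f → 𝔼^ m (λ xs → ∑ᴸ f xs * ∑ᴸ f xs) [] ≤
      (fromℕ m * 𝔼 f) * (fromℕ m * 𝔼 f) + fromℕ m * 𝔼 (λ i → f i * f i)
    second-moment-≤ m f = ≤-by (*-nonNeg (fromℕ-nonNeg m) (square-nonNeg μ))
      (trans
        (solve 3 (λ m μ σ → (m :* μ) :* (m :* μ) :+ m :* σ :=
           ((:0 :+ m :* μ) :* (:0 :+ m :* μ) :+ m :* (σ :- μ :* μ)) :+ m :* (μ :* μ)) refl (fromℕ m) μ σ)
        (+-congʳ (sym (second-moment m f []))))
      where
      μ = 𝔼 f
      σ = 𝔼 (λ i → f i * f i)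

    module _ (0≤b : ∀ i → 0# ≤ b i) where

      opaque
        unfolding 𝔼

        𝔼-mono : ∀ {f g} → (∀ i → i ℕ.< N → f i ≤ g i) → 𝔼 f ≤ 𝔼 g
        𝔼-mono f≤g = ∑<-mono N (λ i i<N → *-monoˡ-≤ (0≤b i) (f≤g i i<N))

      𝔼^-mono : ∀ m {F G} → (∀ xs → F xs ≤ G xs) → ∀ xs → 𝔼^ m F xs ≤ 𝔼^ m G xs
      𝔼^-mono zero    F≤G xs = F≤G xs
      𝔼^-mono (suc m) F≤G xs = 𝔼-mono (λ i _ → 𝔼^-mono m F≤G (i ∷ xs))

      -- Mean and variance of a bilinear statistic of two batches.

      module Bilinear (K : ℕ → ℕ → Carrier) (K-sym : ∀ x y → K x y ≈ K y x) (m : ℕ) where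

        statistic : List ℕ → List ℕ → Carrier
        statistic xs ys = ∑ᴸ (λ y → ∑ᴸ (λ x → K x y) xs) ys

        δ : ℕ → Carrier
        δ x = 𝔼 (K x)

        χ A B m̂ : Carrier
        χ = 𝔼 δ
        A = 𝔼 (λ y → 𝔼 (λ x → K x y * K x y))
        B = 𝔼 (λ x → δ x * δ x)
        m̂ = fromℕ m

        𝔼² : (List ℕ → List ℕ → Carrier) → Carrier
        𝔼² F = 𝔼^ m (λ xs → 𝔼^ m (F xs) []) []

        𝔼²-cong : ∀ {F G} → (∀ xs ys → F xs ys ≈ G xs ys) → 𝔼² F ≈ 𝔼² G
        𝔼²-cong F≈G = 𝔼^-cong m (λ xs → 𝔼^-cong m (F≈G xs) []) []

        𝔼²-mono : ∀ {F G} → (∀ xs ys → F xs ys ≤ G xs ys) → 𝔼² F ≤ 𝔼² G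
        𝔼²-mono F≤G = 𝔼^-mono m (λ xs → 𝔼^-mono m (F≤G xs) []) []

        𝔼²-+ : ∀ F G → 𝔼² (λ xs ys → F xs ys + G xs ys) ≈ 𝔼² F + 𝔼² G
        𝔼²-+ F G = trans (𝔼^-cong m (λ xs → 𝔼^-+ m (F xs) (G xs) []) []) (𝔼^-+ m _ _ [])

        𝔼²-* : ∀ x F → 𝔼² (λ xs ys → x * F xs ys) ≈ x * 𝔼² F
        𝔼²-* x F = trans (𝔼^-cong m (λ xs → 𝔼^-* m x (F xs) []) []) (𝔼^-* m x _ [])

        𝔼²-const : ∀ x → 𝔼² (λ _ _ → x) ≈ x
        𝔼²-const x = trans (𝔼^-cong m (λ xs → 𝔼^-const m x []) []) (𝔼^-const m x [])

        ∑ᴸ-δ : ∀ xs → 𝔼 (λ y → ∑ᴸ (λ x → K x y) xs) ≈ ∑ᴸ δ xs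
        ∑ᴸ-δ []       = 𝔼-const 0#
        ∑ᴸ-δ (x ∷ xs) = trans (𝔼-+ (K x) _) (+-congˡ (∑ᴸ-δ xs))

        statistic-mean : 𝔼² statistic ≈ m̂ * m̂ * χ
        statistic-mean = begin-equality
          𝔼^ m (λ xs → 𝔼^ m (statistic xs) []) []
            ≈⟨ 𝔼^-cong m (λ xs → trans (mean m _ []) (trans (+-identityˡ _) (*-congˡ (∑ᴸ-δ xs)))) [] ⟩
          𝔼^ m (λ xs → m̂ * ∑ᴸ δ xs) []
            ≈⟨ 𝔼^-* m m̂ _ [] ⟩
          m̂ * 𝔼^ m (∑ᴸ δ) []
            ≈⟨ *-congˡ (trans (mean m δ []) (+-identityˡ _)) ⟩
          m̂ * (m̂ * χ)
            ≈⟨ *-assoc _ _ _ ⟨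
          m̂ * m̂ * χ ∎

        -- Conditioning on `xs` leaves two terms. The squared conditional mean is a squared sum of
        -- `δ` over `xs`; it yields the square of the mean and one `B`. In the other term the
        -- expectations are exchanged, so that for fixed `y` it is again a squared sum over `xs`; it
        -- yields the second `B`, by symmetry of `K`, and `A`.
        statistic-second-moment : 𝔼² (λ xs ys → statistic xs ys * statistic xs ys) ≤
          (m̂ * m̂ * χ) * (m̂ * m̂ * χ) + (fromℕ 2 * (m̂ * m̂ * m̂ * B) + m̂ * m̂ * A)
        statistic-second-moment = begin
          𝔼^ m (λ xs → 𝔼^ m (λ ys → statistic xs ys * statistic xs ys) []) []
            ≤⟨ 𝔼^-mono m (λ xs → second-moment-≤ m (λ y → ∑ᴸ (λ x → K x y) xs)) [] ⟩
          𝔼^ m (λ xs → (m̂ * g xs) * (m̂ * g xs) + m̂ * h xs) []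
            ≈⟨ 𝔼^-cong m (λ xs → +-congʳ (trans (*-cong (*-congˡ (∑ᴸ-δ xs)) (*-congˡ (∑ᴸ-δ xs)))
                 (solve 2 (λ m s → (m :* s) :* (m :* s) := (m :* m) :* (s :* s)) refl m̂ (∑ᴸ δ xs)))) [] ⟩
          𝔼^ m (λ xs → (m̂ * m̂) * (∑ᴸ δ xs * ∑ᴸ δ xs) + m̂ * h xs) []
            ≈⟨ trans (𝔼^-+ m _ _ []) (+-cong (𝔼^-* m _ _ []) (𝔼^-* m _ _ [])) ⟩
          (m̂ * m̂) * 𝔼^ m (λ xs → ∑ᴸ δ xs * ∑ᴸ δ xs) [] + m̂ * 𝔼^ m h []
            ≤⟨ +-mono-≤ (*-monoˡ-≤ (square-nonNeg m̂) (second-moment-≤ m δ)) (*-monoˡ-≤ (fromℕ-nonNeg m) h-bound) ⟩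
          (m̂ * m̂) * ((m̂ * χ) * (m̂ * χ) + m̂ * B) + m̂ * (m̂ * m̂ * B + m̂ * A)
            ≈⟨ solve 4 (λ m χ B A →
                 (m :* m) :* ((m :* χ) :* (m :* χ) :+ m :* B) :+ m :* (m :* m :* B :+ m :* A) :=
                 (m :* m :* χ) :* (m :* m :* χ) :+ (:2 :* (m :* m :* m :* B) :+ m :* m :* A)) refl m̂ χ B A ⟩
          (m̂ * m̂ * χ) * (m̂ * m̂ * χ) + (fromℕ 2 * (m̂ * m̂ * m̂ * B) + m̂ * m̂ * A) ∎
          where
          col : List ℕ → ℕ → Carrier
          col xs y = ∑ᴸ (λ x → K x y) xs
          g h : List ℕ → Carrier
          g xs = 𝔼 (col xs)
          h xs = 𝔼 (λ y → col xs y * col xs y)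
          h-bound : 𝔼^ m h [] ≤ m̂ * m̂ * B + m̂ * A
          h-bound = begin
            𝔼^ m h []
              ≈⟨ 𝔼^-𝔼-comm m (λ y xs → col xs y * col xs y) [] ⟩
            𝔼 (λ y → 𝔼^ m (λ xs → col xs y * col xs y) [])
              ≤⟨ 𝔼-mono (λ y _ → second-moment-≤ m (λ x → K x y)) ⟩
            𝔼 (λ y → (m̂ * 𝔼 (λ x → K x y)) * (m̂ * 𝔼 (λ x → K x y)) + m̂ * 𝔼 (λ x → K x y * K x y))
              ≈⟨ 𝔼-cong (λ y _ → +-congʳ (trans (*-cong (*-congˡ (δ-sym y)) (*-congˡ (δ-sym y)))
                   (solve 2 (λ m s → (m :* s) :* (m :* s) := (m :* m) :* (s :* s)) refl m̂ (δ y)))) ⟩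
            𝔼 (λ y → (m̂ * m̂) * (δ y * δ y) + m̂ * 𝔼 (λ x → K x y * K x y))
              ≈⟨ trans (𝔼-+ _ _) (+-cong (𝔼-* _ _) (𝔼-* _ _)) ⟩
            m̂ * m̂ * B + m̂ * A ∎
            where
            δ-sym : ∀ y → 𝔼 (λ x → K x y) ≈ δ y
            δ-sym y = 𝔼-cong (λ x _ → K-sym x y)

        statistic-variance :
          𝔼² (λ xs ys → (statistic xs ys - m̂ * m̂ * χ) * (statistic xs ys - m̂ * m̂ * χ)) ≤
          fromℕ 2 * (m̂ * m̂ * m̂ * B) + m̂ * m̂ * A
        statistic-variance = begin
          𝔼² (λ xs ys → (W xs ys - μ) * (W xs ys - μ))
            ≈⟨ 𝔼²-cong (λ xs ys → solve 2 (λ w μ → (w :- μ) :* (w :- μ) :=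
                 w :* w :+ ((:- (:2 :* μ)) :* w :+ μ :* μ)) refl (W xs ys) μ) ⟩
          𝔼² (λ xs ys → W xs ys * W xs ys + (- (fromℕ 2 * μ) * W xs ys + μ * μ))
            ≈⟨ trans (𝔼²-+ _ _) (+-congˡ (trans (𝔼²-+ _ _) (+-cong (𝔼²-* _ W) (𝔼²-const _)))) ⟩
          𝔼² (λ xs ys → W xs ys * W xs ys) + (- (fromℕ 2 * μ) * 𝔼² W + μ * μ)
            ≤⟨ +-mono-≤ statistic-second-moment (≤-reflexive (+-congʳ (*-congˡ statistic-mean))) ⟩
          (μ * μ + V) + (- (fromℕ 2 * μ) * μ + μ * μ)
            ≈⟨ solve 2 (λ μ V → (μ :* μ :+ V) :+ ((:- (:2 :* μ)) :* μ :+ μ :* μ) := V) refl μ V ⟩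
          V ∎
          where
          W = statistic
          μ = m̂ * m̂ * χ
          V = fromℕ 2 * (m̂ * m̂ * m̂ * B) + m̂ * m̂ * A

-- The chi-square divergence and the moments of its kernel.

module _ {c ℓ₁ ℓ₂} (R : OrderedField c ℓ₁ ℓ₂) where

  open OrderedField R hiding (zero)
  open FieldProperties R
  open Sums R
  open ≤-Reasoning

  module ChiSquare
    (N : ℕ) (a b : ℕ → Carrier) (M : Carrier)
    (0<a : ∀ i → 0# < a i) (0≤b : ∀ i → 0# ≤ b i)
    (∑a≈1 : ∑< N a ≈ 1#) (∑b≈1 : ∑< N b ≈ 1#)
    (1≤Ma : ∀ i → 1# ≤ M * a i)
    where

    open Expectation R N b

    w : ℕ → Carrier
    w i = a i ⁻¹

    -- Averaged over `y` with weights `a`, each row with `x` below `N` vanishes. Averaged with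
    -- weights `b`, it therefore sees only the deviation of `b` from `a`.
    K : ℕ → ℕ → Carrier
    K x y = (if x ℕ.≡ᵇ y then w x else 0#) - 1#

    ≡ᵇ-sym : ∀ x y → (x ℕ.≡ᵇ y) ≡ (y ℕ.≡ᵇ x)
    ≡ᵇ-sym zero    zero    = ≡.refl
    ≡ᵇ-sym zero    (suc y) = ≡.refl
    ≡ᵇ-sym (suc x) zero    = ≡.refl
    ≡ᵇ-sym (suc x) (suc y) = ≡ᵇ-sym x y

    if-≡ᵇ-cong : ∀ (f : ℕ → Carrier) z x y →
                 (if x ℕ.≡ᵇ y then f x else z) ≡ (if x ℕ.≡ᵇ y then f y else z)
    if-≡ᵇ-cong f z x y with x ℕ.≡ᵇ y in eq
    ... | false = ≡.refl
    ... | true  = ≡.cong f (ℕₚ.≡ᵇ⇒≡ x y (≡.subst T (≡.sym eq) tt))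

    K-sym : ∀ x y → K x y ≈ K y x
    K-sym x y = reflexive (≡.cong (_- 1#)
      (≡.trans (if-≡ᵇ-cong w 0# x y) (≡.cong (λ e → if e then w y else 0#) (≡ᵇ-sym x y))))

    aw≈1 : ∀ i → a i * w i ≈ 1#
    aw≈1 i = *-inverseʳ (a i) (>⇒≉ (0<a i))

    0≤w : ∀ i → 0# ≤ w i
    0≤w i = ⁻¹-nonNeg (0<a i)

    w≤M : ∀ i → w i ≤ M
    w≤M i = *-cancelˡ-≤ (0<a i) (≤-respˡ (sym (aw≈1 i)) (≤-respʳ (*-comm M (a i)) (1≤Ma i)))

    opaque
      unfolding 𝔼

      𝔼-delta : ∀ {x} (f : ℕ → Carrier) → x ℕ.< N →
                𝔼 (λ i → if x ℕ.≡ᵇ i then f i else 0#) ≈ b x * f x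
      𝔼-delta {x} f x<N = trans (∑<-cong N (λ i _ → push i)) (∑<-delta N (λ i → b i * f i) x x<N)
        where
        push : ∀ i → b i * (if x ℕ.≡ᵇ i then f i else 0#) ≈ (if x ℕ.≡ᵇ i then b i * f i else 0#)
        push i with x ℕ.≡ᵇ i
        ... | true  = refl
        ... | false = zeroʳ _

    module Deviation (m : ℕ) where

      open Bilinear ∑b≈1 0≤b K K-sym m public

      δ≈ : ∀ x → x ℕ.< N → δ x ≈ b x * w x - 1#
      δ≈ x x<N = begin-equality
        𝔼 (λ y → (if x ℕ.≡ᵇ y then w x else 0#) - 1#)
          ≈⟨ trans (𝔼-+ _ _) (+-congˡ (𝔼-const ∑b≈1 _)) ⟩
        𝔼 (λ y → if x ℕ.≡ᵇ y then w x else 0#) - 1#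
          ≈⟨ +-congʳ (𝔼-delta (λ _ → w x) x<N) ⟩
        b x * w x - 1# ∎

      b≈ : ∀ x → x ℕ.< N → b x ≈ a x * (1# + δ x)
      b≈ x x<N = begin-equality
        b x                            ≈⟨ *-identityʳ _ ⟨
        b x * 1#                       ≈⟨ *-congˡ (aw≈1 x) ⟨
        b x * (a x * w x)              ≈⟨ solve 3 (λ a b w → b :* (a :* w) := a :* (:1 :+ (b :* w :- :1))) refl (a x) (b x) (w x) ⟩
        a x * (1# + (b x * w x - 1#))  ≈⟨ *-congˡ (+-congˡ (δ≈ x x<N)) ⟨
        a x * (1# + δ x)               ∎

      aδ≈ : ∀ x → x ℕ.< N → b x - a x ≈ a x * δ x
      aδ≈ x x<N = trans (+-congʳ (b≈ x x<N))
        (solve 2 (λ a δ → a :* (:1 :+ δ) :- a := a :* δ) refl (a x) (δ x))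

      0≤aδ² : ∀ x → 0# ≤ a x * (δ x * δ x)
      0≤aδ² x = *-nonNeg (proj₁ (0<a x)) (square-nonNeg (δ x))

      opaque
        unfolding 𝔼

        -- Since `b = a (1 + δ)`, the summand `b δ` splits into `a δ²` and `a δ = b - a`; the latter
        -- sums to 0 because both masses are 1.
        χ≈∑aδ² : χ ≈ ∑< N (λ x → a x * (δ x * δ x))
        χ≈∑aδ² = begin-equality
          ∑< N (λ x → b x * δ x)
            ≈⟨ ∑<-cong N (λ x x<N → trans (*-congʳ (b≈ x x<N))
                 (trans (solve 2 (λ a δ → a :* (:1 :+ δ) :* δ := a :* (δ :* δ) :+ a :* δ) refl (a x) (δ x))
                   (+-congˡ (trans (sym (aδ≈ x x<N)) (+-congˡ (neg≈ x)))))) ⟩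
          ∑< N (λ x → a x * (δ x * δ x) + (b x + - 1# * a x))
            ≈⟨ trans (∑<-+ N _ _) (+-congˡ (trans (∑<-+ N _ _) (+-cong ∑b≈1 (trans (∑<-* N _ _) (*-congˡ ∑a≈1))))) ⟩
          ∑< N (λ x → a x * (δ x * δ x)) + (1# + - 1# * 1#)
            ≈⟨ solve 1 (λ s → s :+ (:1 :+ (:- :1) :* :1) := s) refl _ ⟩
          ∑< N (λ x → a x * (δ x * δ x)) ∎
          where
          neg≈ : ∀ x → - a x ≈ - 1# * a x
          neg≈ x = solve 1 (λ a → :- a := (:- :1) :* a) refl (a x)

      0≤χ : 0# ≤ χ
      0≤χ = ≤-respʳ (sym χ≈∑aδ²) (∑<-nonNeg N (λ x _ → 0≤aδ² x))

      -- Bounding one factor of `w y * w y` by `M` makes the second moment for fixed `y` affine in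
      -- `δ y`, and averaging `δ` gives `χ`.
      A≤ : A ≤ M * (1# + χ)
      A≤ = begin
        A
          ≤⟨ 𝔼-mono ∑b≈1 0≤b σ≤ ⟩
        𝔼 (λ y → (M - fromℕ 2) * δ y + (M - 1#))
          ≈⟨ trans (𝔼-+ _ _) (+-cong (𝔼-* _ _) (𝔼-const ∑b≈1 _)) ⟩
        (M - fromℕ 2) * χ + (M - 1#)
          ≤⟨ ≤-by (+-nonNeg (+-nonNeg 0≤χ 0≤χ) 0≤1)
               (solve 2 (λ M χ → M :* (:1 :+ χ) := (M :- :2) :* χ :+ (M :- :1) :+ (χ :+ χ :+ :1)) refl M χ) ⟩
        M * (1# + χ) ∎
        where
        KK≈ : ∀ x y → K x y * K x y ≈
              (if y ℕ.≡ᵇ x then w y * w y - fromℕ 2 * w y else 0#) + 1#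
        KK≈ x y = trans (*-cong (K-sym x y) (K-sym x y)) K²≈
          where
          K²≈ : K y x * K y x ≈ (if y ℕ.≡ᵇ x then w y * w y - fromℕ 2 * w y else 0#) + 1#
          K²≈ with y ℕ.≡ᵇ x
          ... | true  = solve 1 (λ w → (w :- :1) :* (w :- :1) := (w :* w :- :2 :* w) :+ :1) refl (w y)
          ... | false = solve 0 ((:0 :- :1) :* (:0 :- :1) := :0 :+ :1) refl
        σ≤ : ∀ y → y ℕ.< N → 𝔼 (λ x → K x y * K x y) ≤ (M - fromℕ 2) * δ y + (M - 1#)
        σ≤ y y<N = begin
          𝔼 (λ x → K x y * K x y)
            ≈⟨ trans (𝔼-cong (λ x _ → KK≈ x y)) (trans (𝔼-+ _ _)
                 (+-cong (𝔼-delta (λ _ → w y * w y - fromℕ 2 * w y) y<N) (𝔼-const ∑b≈1 1#))) ⟩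
          b y * (w y * w y - fromℕ 2 * w y) + 1#
            ≤⟨ ≤-by (*-nonNeg (*-nonNeg (0≤b y) (0≤w y)) (≤⇒0≤y-x (w≤M y)))
                 (solve 3 (λ M b w → (M :- :2) :* (b :* w :- :1) :+ (M :- :1) :=
                    b :* (w :* w :- :2 :* w) :+ :1 :+ (b :* w) :* (M :- w)) refl M (b y) (w y)) ⟩
          (M - fromℕ 2) * (b y * w y - 1#) + (M - 1#)
            ≈⟨ +-congʳ (*-congˡ (δ≈ y y<N)) ⟨
          (M - fromℕ 2) * δ y + (M - 1#) ∎

      ℓ₁-distance : Carrier
      ℓ₁-distance = ∑< N (λ x → ∣ b x - a x ∣)

      -- Cauchy–Schwarz, from the sum over x of (∣b − a∣ − L a)² / a ≥ 0 with
      -- L the ℓ₁-distance.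
      ℓ₁²≤χ : ℓ₁-distance * ℓ₁-distance ≤ χ
      ℓ₁²≤χ = begin
        L * L
          ≈⟨ solve 1 (λ l → l :* l := (:2 :* l) :* l :+ (:- (l :* l)) :* :1) refl L ⟩
        (fromℕ 2 * L) * L + - (L * L) * 1#
          ≈⟨ +-cong (∑<-* N _ _) (trans (∑<-* N _ _) (*-congˡ ∑a≈1)) ⟨
        ∑< N (λ x → (fromℕ 2 * L) * ∣ b x - a x ∣) + ∑< N (λ x → - (L * L) * a x)
          ≈⟨ ∑<-+ N _ _ ⟨
        ∑< N (λ x → (fromℕ 2 * L) * ∣ b x - a x ∣ + - (L * L) * a x)
          ≤⟨ ∑<-mono N (λ x x<N → *-cancelˡ-≤ (0<a x) (pointwise x x<N)) ⟩
        ∑< N (λ x → a x * (δ x * δ x))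
          ≈⟨ χ≈∑aδ² ⟨
        χ ∎
        where
        L = ℓ₁-distance
        pointwise : ∀ x → x ℕ.< N →
          a x * ((fromℕ 2 * L) * ∣ b x - a x ∣ + - (L * L) * a x) ≤ a x * (a x * (δ x * δ x))
        pointwise x x<N = begin
          a x * ((fromℕ 2 * L) * t + - (L * L) * a x)
            ≤⟨ ≤-by (square-nonNeg (t - L * a x))
                 (solve 3 (λ a l t → t :* t := a :* ((:2 :* l) :* t :+ (:- (l :* l)) :* a) :+
                    (t :- l :* a) :* (t :- l :* a)) refl (a x) L t) ⟩
          t * t
            ≈⟨ ∣∣-square _ ⟩
          (b x - a x) * (b x - a x)
            ≈⟨ *-cong (aδ≈ x x<N) (aδ≈ x x<N) ⟩
          (a x * δ x) * (a x * δ x)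
            ≈⟨ solve 2 (λ a δ → (a :* δ) :* (a :* δ) := a :* (a :* (δ :* δ))) refl (a x) (δ x) ⟩
          a x * (a x * (δ x * δ x)) ∎
          where t = ∣ b x - a x ∣

      module _ {D} (0≤D : 0# ≤ D) (Mχ≤D² : M * χ ≤ D * D) where

        -- A single term of the sum for `χ`, divided by its weight: `δ x * δ x ≤ w x * χ ≤ M * χ`.
        -- Here `D` takes the part of the square root of `M * χ`.
        δ≤D : ∀ x → x ℕ.< N → δ x ≤ D
        δ≤D x x<N = square-cancel-≤ 0≤D (begin
          δ x * δ x                    ≈⟨ *-identityˡ _ ⟨
          1# * (δ x * δ x)             ≈⟨ *-congʳ (aw≈1 x) ⟨
          a x * w x * (δ x * δ x)      ≈⟨ solve 3 (λ a w s → a :* w :* s := w :* (a :* s)) refl (a x) (w x) (δ x * δ x) ⟩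
          w x * (a x * (δ x * δ x))    ≤⟨ *-monoˡ-≤ (0≤w x) (term≤∑< N (λ x → a x * (δ x * δ x)) x (λ y _ → 0≤aδ² y) x<N) ⟩
          w x * ∑< N (λ x → a x * (δ x * δ x))  ≈⟨ *-congˡ χ≈∑aδ² ⟨
          w x * χ                      ≤⟨ *-monoʳ-≤ 0≤χ (w≤M x) ⟩
          M * χ                        ≤⟨ Mχ≤D² ⟩
          D * D                        ∎)

        opaque
          unfolding 𝔼

          -- Passing from `b` to `a (1 + δ)` turns `B` into the sum for `χ` with each term
          -- multiplied by `1 + δ`, which is at most `1 + D`.
          B≤ : B ≤ χ * (1# + D)
          B≤ = begin
            ∑< N (λ x → b x * (δ x * δ x))
              ≈⟨ ∑<-cong N (λ x x<N → trans (*-congʳ (b≈ x x<N))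
                   (solve 2 (λ a δ → a :* (:1 :+ δ) :* (δ :* δ) := (a :* (δ :* δ)) :* (:1 :+ δ)) refl (a x) (δ x))) ⟩
            ∑< N (λ x → (a x * (δ x * δ x)) * (1# + δ x))
              ≤⟨ ∑<-mono N (λ x x<N → ≤-respʳ (*-comm _ _) (*-monoˡ-≤ (0≤aδ² x) (+-monoʳ-≤ 1# (δ≤D x x<N)))) ⟩
            ∑< N (λ x → (1# + D) * (a x * (δ x * δ x)))
              ≈⟨ ∑<-* N _ _ ⟩
            (1# + D) * ∑< N (λ x → a x * (δ x * δ x))
              ≈⟨ trans (*-congˡ (sym χ≈∑aδ²)) (*-comm _ _) ⟩
            χ * (1# + D) ∎

      module _ (b≈a : ∀ i → b i ≈ a i) where

        δ≈0 : ∀ x → x ℕ.< N → δ x ≈ 0#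
        δ≈0 x x<N = trans (δ≈ x x<N) (trans (+-congʳ (trans (*-congʳ (b≈a x)) (aw≈1 x))) (-‿inverseʳ 1#))

        χ≈0 : χ ≈ 0#
        χ≈0 = trans (𝔼-cong δ≈0) (𝔼-const ∑b≈1 0#)

        B≈0 : B ≈ 0#
        B≈0 = trans (𝔼-cong (λ x x<N → trans (*-congʳ (δ≈0 x x<N)) (zeroˡ _))) (𝔼-const ∑b≈1 0#)

        null-second-moment : 𝔼² (λ xs ys → statistic xs ys * statistic xs ys) ≤ m̂ * m̂ * M
        null-second-moment = begin
          𝔼² (λ xs ys → statistic xs ys * statistic xs ys)
            ≤⟨ statistic-second-moment ⟩
          (m̂ * m̂ * χ) * (m̂ * m̂ * χ) + (fromℕ 2 * (m̂ * m̂ * m̂ * B) + m̂ * m̂ * A)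
            ≤⟨ +-monoʳ-≤ _ (+-monoʳ-≤ _ (*-monoˡ-≤ (square-nonNeg m̂) A≤)) ⟩
          (m̂ * m̂ * χ) * (m̂ * m̂ * χ) + (fromℕ 2 * (m̂ * m̂ * m̂ * B) + m̂ * m̂ * (M * (1# + χ)))
            ≈⟨ +-cong (*-cong (*-congˡ χ≈0) (*-congˡ χ≈0)) (+-cong (*-congˡ (*-congˡ B≈0)) (*-congˡ (*-congˡ (+-congˡ χ≈0)))) ⟩
          (m̂ * m̂ * 0#) * (m̂ * m̂ * 0#) + (fromℕ 2 * (m̂ * m̂ * m̂ * 0#) + m̂ * m̂ * (M * (1# + 0#)))
            ≈⟨ solve 2 (λ m M → (m :* m :* :0) :* (m :* m :* :0) :+ (:2 :* (m :* m :* m :* :0) :+ m :* m :* (M :* (:1 :+ :0))) :=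
                 m :* m :* M) refl m̂ M ⟩
          m̂ * m̂ * M ∎

-- Chebyshev bounds for the two error probabilities.

module _ {c ℓ₁ ℓ₂} (R : OrderedField c ℓ₁ ℓ₂) where

  open OrderedField R
  open FieldProperties R
  open Sums R
  open ≤-Reasoning

  -- The number 64 serves three times: as 8², from clearing the denominator of the threshold; as 16
  -- · 4 in the comparison of `M` with the sample size; and as a number above 49 in the far case.
  module ErrorBounds (κ : Carrier) (64≤κ : fromℕ 64 ≤ κ) where

    fromℕ≤κ : ∀ {k} → k ℕ.≤ 64 → fromℕ k ≤ κ
    fromℕ≤κ k≤64 = ≤-trans (fromℕ-mono-≤ k≤64) 64≤κ

    0<κ : 0# < κ
    0<κ = <-≤-trans (fromℕ-pos {64} (s≤s z≤n)) 64≤κ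

    -- Here `e` stands for ε². Multiplying Chebyshev's inequality through by `n` and inserting the
    -- sample size leaves `κ * κ * P ≤ 4`, and `κ * κ` is at least 12.
    null-error-≤⅓ : ∀ {P m n M e} → 0# < m → 0# < n → 0# ≤ P → M ≤ fromℕ 4 * n →
      κ * κ * κ * n ≤ m * m * (e * e) →
      (m * m * e) * (m * m * e) * P ≤ κ * (m * m * M) → fromℕ 3 * P ≤ 1#
    null-error-≤⅓ {P} {m} {n} {M} {e} 0<m 0<n 0≤P M≤4n enough chebyshev =
      *-cancelˡ-≤ (fromℕ-pos {4} (s≤s z≤n)) (begin
        fromℕ 4 * (fromℕ 3 * P)  ≈⟨ solve 1 (λ P → :4 :* (:n 3 :* P) := :n 12 :* :1 :* P) refl P ⟩
        fromℕ 12 * 1# * P        ≤⟨ *-monoʳ-≤ 0≤P (*-mono-≤ (proj₁ 0<κ) 0≤1 (fromℕ≤κ (ℕₚ.m≤m+n 12 52)) ≤-refl) ⟩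
        κ * 1# * P               ≤⟨ *-monoʳ-≤ 0≤P (*-monoˡ-≤ (proj₁ 0<κ) (≤-respˡ fromℕ-1 (fromℕ≤κ (s≤s z≤n)))) ⟩
        κ * κ * P                ≤⟨ *-cancelˡ-≤ (*-pos 0<κ (*-pos (*-pos 0<m 0<m) 0<n)) bound ⟩
        fromℕ 4                  ≈⟨ *-identityʳ _ ⟨
        fromℕ 4 * 1#             ∎)
      where
      bound : κ * (m * m * n) * (κ * κ * P) ≤ κ * (m * m * n) * fromℕ 4
      bound = begin
        κ * (m * m * n) * (κ * κ * P)     ≈⟨ solve 4 (λ k m n P → k :* (m :* m :* n) :* (k :* k :* P) := (m :* m :* P) :* (k :* k :* k :* n)) refl κ m n P ⟩
        (m * m * P) * (κ * κ * κ * n)     ≤⟨ *-monoˡ-≤ (*-nonNeg (square-nonNeg m) 0≤P) enough ⟩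
        (m * m * P) * (m * m * (e * e))   ≈⟨ solve 3 (λ m e P → (m :* m :* P) :* (m :* m :* (e :* e)) := (m :* m :* e) :* (m :* m :* e) :* P) refl m e P ⟩
        (m * m * e) * (m * m * e) * P     ≤⟨ chebyshev ⟩
        κ * (m * m * M)                   ≤⟨ *-monoˡ-≤ (proj₁ 0<κ) (*-monoˡ-≤ (square-nonNeg m) M≤4n) ⟩
        κ * (m * m * (fromℕ 4 * n))       ≈⟨ solve 3 (λ k m n → k :* (m :* m :* (:4 :* n)) := k :* (m :* m :* n) :* :4) refl κ m n ⟩
        κ * (m * m * n) * fromℕ 4         ∎

    -- Substituting `κ * D` for `m * χ` makes `m² D²` a common factor of both sides, since
    -- `1 ≤ M ≤ D²` gives `D ≤ D²`. Cancelling it leaves `κ² P ≤ 16κ + 8`. Three times the right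
    -- side is at most `49κ`, hence at most `κ²`.
    far-error-≤⅓ : ∀ {P m M χ B D} → 0# < m → 0# ≤ P → 0# ≤ D → 1# ≤ M → M ≤ D * D → M * χ ≤ D * D →
      κ * D ≈ m * χ → B ≤ χ * (1# + D) →
      (m * m * χ) * (m * m * χ) * P ≤ fromℕ 4 * (fromℕ 2 * (m * m * m * B) + m * m * (M * (1# + χ))) →
      fromℕ 3 * P ≤ 1#
    far-error-≤⅓ {P} {m} {M} {χ} {B} {D} 0<m 0≤P 0≤D 1≤M M≤D² Mχ≤D² κD≈mχ B≤ chebyshev =
      *-cancelˡ-≤ (*-pos 0<κ 0<κ) (begin
        κ * κ * (fromℕ 3 * P)
          ≈⟨ solve 2 (λ k P → k :* k :* (:n 3 :* P) := :n 3 :* (k :* k :* P)) refl κ P ⟩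
        fromℕ 3 * (κ * κ * P)
          ≤⟨ *-monoˡ-≤ (fromℕ-nonNeg 3) (*-cancelˡ-≤ (*-pos (*-pos 0<m 0<m) 0<D²) bound) ⟩
        fromℕ 3 * (fromℕ 16 * κ + fromℕ 8)
          ≈⟨ solve 1 (λ k → :n 3 :* (:n 16 :* k :+ :n 8) := :n 48 :* k :+ :n 24) refl κ ⟩
        fromℕ 48 * κ + fromℕ 24
          ≤⟨ +-monoʳ-≤ _ (fromℕ≤κ (ℕₚ.m≤m+n 24 40)) ⟩
        fromℕ 48 * κ + κ
          ≈⟨ solve 1 (λ k → :n 48 :* k :+ k := :n 49 :* k) refl κ ⟩
        fromℕ 49 * κ
          ≤⟨ *-monoʳ-≤ (proj₁ 0<κ) (fromℕ≤κ (ℕₚ.m≤m+n 49 15)) ⟩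
        κ * κ
          ≈⟨ *-identityʳ _ ⟨
        κ * κ * 1# ∎)
      where
      1≤D² : 1# ≤ D * D
      1≤D² = ≤-trans 1≤M M≤D²
      0<D² : 0# < D * D
      0<D² = <-≤-trans 0<1 1≤D²
      1≤D : 1# ≤ D
      1≤D = square-cancel-≤ 0≤D (≤-respˡ (sym (*-identityʳ 1#)) 1≤D²)
      D≤D² : D ≤ D * D
      D≤D² = ≤-respˡ (*-identityʳ D) (*-monoˡ-≤ 0≤D 1≤D)
      0≤m³ : 0# ≤ m * m * m
      0≤m³ = *-nonNeg (square-nonNeg m) (proj₁ 0<m)
      0≤8κ : 0# ≤ fromℕ 8 * κ
      0≤8κ = *-nonNeg (fromℕ-nonNeg 8) (proj₁ 0<κ)
      bound : m * m * (D * D) * (κ * κ * P) ≤ m * m * (D * D) * (fromℕ 16 * κ + fromℕ 8)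
      bound = begin
        m * m * (D * D) * (κ * κ * P)
          ≈⟨ solve 4 (λ m D k P → m :* m :* (D :* D) :* (k :* k :* P) := m :* m :* ((k :* D) :* (k :* D)) :* P) refl m D κ P ⟩
        m * m * ((κ * D) * (κ * D)) * P
          ≈⟨ *-congʳ (*-congˡ (*-cong κD≈mχ κD≈mχ)) ⟩
        m * m * ((m * χ) * (m * χ)) * P
          ≈⟨ solve 3 (λ m χ P → m :* m :* ((m :* χ) :* (m :* χ)) :* P := (m :* m :* χ) :* (m :* m :* χ) :* P) refl m χ P ⟩
        (m * m * χ) * (m * m * χ) * P
          ≤⟨ chebyshev ⟩
        fromℕ 4 * (fromℕ 2 * (m * m * m * B) + m * m * (M * (1# + χ)))
          ≤⟨ *-monoˡ-≤ (fromℕ-nonNeg 4) (+-mono-≤ (*-monoˡ-≤ (fromℕ-nonNeg 2) (*-monoˡ-≤ 0≤m³ B≤)) ≤-refl) ⟩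
        fromℕ 4 * (fromℕ 2 * (m * m * m * (χ * (1# + D))) + m * m * (M * (1# + χ)))
          ≈⟨ solve 4 (λ m χ D M → :4 :* (:2 :* (m :* m :* m :* (χ :* (:1 :+ D))) :+ m :* m :* (M :* (:1 :+ χ))) :=
               m :* m :* (:n 8 :* (m :* χ) :* (:1 :+ D) :+ :4 :* (M :+ M :* χ))) refl m χ D M ⟩
        m * m * (fromℕ 8 * (m * χ) * (1# + D) + fromℕ 4 * (M + M * χ))
          ≈⟨ *-congˡ (+-congʳ (*-congʳ (*-congˡ κD≈mχ))) ⟨
        m * m * (fromℕ 8 * (κ * D) * (1# + D) + fromℕ 4 * (M + M * χ))
          ≈⟨ solve 5 (λ m D k M X → m :* m :* (:n 8 :* (k :* D) :* (:1 :+ D) :+ :4 :* (M :+ X)) :=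
               m :* m :* (:n 8 :* k :* D :+ (:n 8 :* k :* (D :* D) :+ :4 :* (M :+ X)))) refl m D κ M (M * χ) ⟩
        m * m * (fromℕ 8 * κ * D + (fromℕ 8 * κ * (D * D) + fromℕ 4 * (M + M * χ)))
          ≤⟨ *-monoˡ-≤ (square-nonNeg m) (+-mono-≤ (*-monoˡ-≤ 0≤8κ D≤D²)
               (+-monoʳ-≤ _ (*-monoˡ-≤ (fromℕ-nonNeg 4) (+-mono-≤ M≤D² Mχ≤D²)))) ⟩
        m * m * (fromℕ 8 * κ * (D * D) + (fromℕ 8 * κ * (D * D) + fromℕ 4 * (D * D + D * D)))
          ≈⟨ solve 3 (λ m k d → m :* m :* (:n 8 :* k :* d :+ (:n 8 :* k :* d :+ :4 :* (d :+ d))) :=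
               m :* m :* d :* (:n 16 :* k :+ :n 8)) refl m κ (D * D) ⟩
        m * m * (D * D) * (fromℕ 16 * κ + fromℕ 8) ∎

  module Threshold
    (N : ℕ) (a b : ℕ → Carrier) (M : Carrier)
    (0<a : ∀ i → 0# < a i) (0≤b : ∀ i → 0# ≤ b i)
    (∑a≈1 : ∑< N a ≈ 1#) (∑b≈1 : ∑< N b ≈ 1#)
    (1≤Ma : ∀ i → 1# ≤ M * a i) (1≤M : 1# ≤ M)
    (m : ℕ) (n κ ε : Carrier) (0<n : 0# < n) (64≤κ : fromℕ 64 ≤ κ) (0<ε : 0# < ε)
    (M≤4n : M ≤ fromℕ 4 * n)
    (enough : κ * κ * κ * n ≤ fromℕ m * fromℕ m * (ε * ε * (ε * ε)))
    where

    open Expectation R N b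
    open ChiSquare R N a b M 0<a 0≤b ∑a≈1 ∑b≈1 1≤Ma
    open Deviation m
    open ErrorBounds κ 64≤κ

    -- Eight times the threshold. In the far case the mean is at least `m²ε²/4`, and the threshold
    -- is half of that.
    θ : Carrier
    θ = m̂ * m̂ * (ε * ε)

    0≤θ : 0# ≤ θ
    0≤θ = *-nonNeg (square-nonNeg m̂) (square-nonNeg ε)

    passes : List ℕ → List ℕ → Bool
    passes xs ys = ⌊ fromℕ 8 * statistic xs ys ≤? θ ⌋

    accepted rejected : List ℕ → List ℕ → Carrier
    accepted xs ys = if passes xs ys then 1# else 0#
    rejected xs ys = if passes xs ys then 0# else 1#

    0<m̂ : 0# < m̂
    0<m̂ = fromℕ-nonNeg m , λ 0≈m̂ → >⇒≉ 0<m²ε⁴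
      (trans (*-congʳ (trans (*-congʳ (sym 0≈m̂)) (zeroˡ m̂))) (zeroˡ _))
      where
      0<m²ε⁴ : 0# < m̂ * m̂ * (ε * ε * (ε * ε))
      0<m²ε⁴ = <-≤-trans (*-pos (*-pos (*-pos 0<κ 0<κ) 0<κ) 0<n) enough

    𝔼²-nonNeg : ∀ {F} → (∀ xs ys → 0# ≤ F xs ys) → 0# ≤ 𝔼² F
    𝔼²-nonNeg 0≤F = ≤-respˡ (𝔼²-const 0#) (𝔼²-mono 0≤F)

    accepted-nonNeg : ∀ xs ys → 0# ≤ accepted xs ys
    accepted-nonNeg xs ys with passes xs ys
    ... | true  = 0≤1
    ... | false = ≤-refl

    rejected-nonNeg : ∀ xs ys → 0# ≤ rejected xs ys
    rejected-nonNeg xs ys with passes xs ys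
    ... | true  = ≤-refl
    ... | false = 0≤1

    null-error : (∀ i → b i ≈ a i) → fromℕ 3 * 𝔼² rejected ≤ 1#
    null-error b≈a = null-error-≤⅓ 0<m̂ 0<n (𝔼²-nonNeg rejected-nonNeg) M≤4n enough (begin
      θ * θ * 𝔼² rejected                                    ≈⟨ 𝔼²-* (θ * θ) rejected ⟨
      𝔼² (λ xs ys → θ * θ * rejected xs ys)                  ≤⟨ 𝔼²-mono markov ⟩
      𝔼² (λ xs ys → fromℕ 64 * (statistic xs ys * statistic xs ys))  ≈⟨ 𝔼²-* (fromℕ 64) _ ⟩
      fromℕ 64 * 𝔼² (λ xs ys → statistic xs ys * statistic xs ys)    ≤⟨ *-monoˡ-≤ (fromℕ-nonNeg 64) (null-second-moment b≈a) ⟩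
      fromℕ 64 * (m̂ * m̂ * M)                                 ≤⟨ *-monoʳ-≤ (*-nonNeg (square-nonNeg m̂) (≤-trans 0≤1 1≤M)) 64≤κ ⟩
      κ * (m̂ * m̂ * M)                                        ∎)
      where
      markov : ∀ xs ys → θ * θ * rejected xs ys ≤ fromℕ 64 * (statistic xs ys * statistic xs ys)
      markov xs ys with fromℕ 8 * statistic xs ys ≤? θ
      ... | yes _    = ≤-respˡ (sym (zeroʳ _)) (*-nonNeg (fromℕ-nonNeg 64) (square-nonNeg _))
      ... | no 8W≰θ = ≤-respˡ (sym (*-identityʳ _))
        (≤-respʳ (solve 1 (λ W → (:n 8 :* W) :* (:n 8 :* W) := :n 64 :* (W :* W)) refl (statistic xs ys))
          (*-mono-≤ (≤-trans 0≤θ θ≤8W) 0≤θ θ≤8W θ≤8W))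
        where θ≤8W = ≰⇒≥ 8W≰θ

    module _ (ε≤2 : ε ≤ fromℕ 2) (ε≤2L : ε ≤ fromℕ 2 * ℓ₁-distance) where

      ε²≤4χ : ε * ε ≤ fromℕ 4 * χ
      ε²≤4χ = begin
        ε * ε                                               ≤⟨ *-mono-≤ (≤-trans (proj₁ 0<ε) ε≤2L) (proj₁ 0<ε) ε≤2L ε≤2L ⟩
        (fromℕ 2 * ℓ₁-distance) * (fromℕ 2 * ℓ₁-distance)   ≈⟨ solve 1 (λ l → (:2 :* l) :* (:2 :* l) := :4 :* (l :* l)) refl ℓ₁-distance ⟩
        fromℕ 4 * (ℓ₁-distance * ℓ₁-distance)               ≤⟨ *-monoˡ-≤ (fromℕ-nonNeg 4) ℓ₁²≤χ ⟩
        fromℕ 4 * χ                                         ∎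

      ε²≤4 : ε * ε ≤ fromℕ 4
      ε²≤4 = ≤-respʳ (solve 0 (:2 :* :2 := :4) refl)
        (*-mono-≤ (fromℕ-nonNeg 2) (proj₁ 0<ε) ε≤2 ε≤2)

      -- Chosen so that the squared mean `m⁴χ²` becomes exactly `κ² m² D²`. Being an upper bound for
      -- the square root of `M χ` is all that is asked of it otherwise, apart from `M ≤ D²`.
      D : Carrier
      D = κ ⁻¹ * (m̂ * χ)

      κD≈ : κ * D ≈ m̂ * χ
      κD≈ = trans (sym (*-assoc _ _ _)) (trans (*-congʳ (*-inverseʳ κ (>⇒≉ 0<κ))) (*-identityˡ _))

      0≤D : 0# ≤ D
      0≤D = *-nonNeg (⁻¹-nonNeg 0<κ) (*-nonNeg (fromℕ-nonNeg m) 0≤χ)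

      κ²D²≈ : κ * κ * (D * D) ≈ m̂ * m̂ * (χ * χ)
      κ²D²≈ = trans (solve 2 (λ k d → k :* k :* (d :* d) := (k :* d) :* (k :* d)) refl κ D)
        (trans (*-cong κD≈ κD≈) (solve 2 (λ m χ → (m :* χ) :* (m :* χ) := m :* m :* (χ :* χ)) refl m̂ χ))

      -- One of the three factors `κ` of the sample size is spent on the constants: `M ≤ 4n` costs
      -- 4, and 16 · 4 is at most `κ`.
      16κ²M≤m²ε⁴ : fromℕ 16 * (κ * κ * M) ≤ m̂ * m̂ * (ε * ε * (ε * ε))
      16κ²M≤m²ε⁴ = begin
        fromℕ 16 * (κ * κ * M)               ≤⟨ *-monoˡ-≤ (fromℕ-nonNeg 16) (*-monoˡ-≤ (square-nonNeg κ) M≤4n) ⟩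
        fromℕ 16 * (κ * κ * (fromℕ 4 * n))   ≈⟨ solve 2 (λ k n → :n 16 :* (k :* k :* (:4 :* n)) := :n 64 :* (k :* k :* n)) refl κ n ⟩
        fromℕ 64 * (κ * κ * n)               ≤⟨ *-monoʳ-≤ (*-nonNeg (square-nonNeg κ) (proj₁ 0<n)) 64≤κ ⟩
        κ * (κ * κ * n)                      ≈⟨ solve 2 (λ k n → k :* (k :* k :* n) := k :* k :* k :* n) refl κ n ⟩
        κ * κ * κ * n                        ≤⟨ enough ⟩
        m̂ * m̂ * (ε * ε * (ε * ε))            ∎

      -- The common source of both bounds on `D`. For `t = χ²` the premise is the square of
      -- `ε² ≤ 4χ`; for `t = χ` one factor `ε²` is bounded by 4 instead.
      κ²M≤ : ∀ t → ε * ε * (ε * ε) ≤ fromℕ 16 * t → κ * κ * M ≤ m̂ * m̂ * t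
      κ²M≤ t ε⁴≤16t = *-cancelˡ-≤ (fromℕ-pos {16} (s≤s z≤n)) (begin
        fromℕ 16 * (κ * κ * M)        ≤⟨ 16κ²M≤m²ε⁴ ⟩
        m̂ * m̂ * (ε * ε * (ε * ε))     ≤⟨ *-monoˡ-≤ (square-nonNeg m̂) ε⁴≤16t ⟩
        m̂ * m̂ * (fromℕ 16 * t)        ≈⟨ solve 3 (λ s k t → s :* (k :* t) := k :* (s :* t)) refl (m̂ * m̂) (fromℕ 16) t ⟩
        fromℕ 16 * (m̂ * m̂ * t)        ∎)

      M≤D² : M ≤ D * D
      M≤D² = *-cancelˡ-≤ (*-pos 0<κ 0<κ) (≤-respʳ (sym κ²D²≈) (κ²M≤ (χ * χ)
        (≤-respʳ (solve 1 (λ χ → (:4 :* χ) :* (:4 :* χ) := :n 16 :* (χ :* χ)) refl χ)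
          (*-mono-≤ (*-nonNeg (fromℕ-nonNeg 4) 0≤χ) (square-nonNeg ε) ε²≤4χ ε²≤4χ))))

      Mχ≤D² : M * χ ≤ D * D
      Mχ≤D² = *-cancelˡ-≤ (*-pos 0<κ 0<κ) (begin
        κ * κ * (M * χ)        ≈⟨ *-assoc _ _ _ ⟨
        κ * κ * M * χ          ≤⟨ *-monoʳ-≤ 0≤χ (κ²M≤ χ
                                    (≤-respʳ (solve 1 (λ χ → :4 :* (:4 :* χ) := :n 16 :* χ) refl χ)
                                      (*-mono-≤ (fromℕ-nonNeg 4) (square-nonNeg ε) ε²≤4 ε²≤4χ))) ⟩
        m̂ * m̂ * χ * χ          ≈⟨ *-assoc _ _ _ ⟩
        m̂ * m̂ * (χ * χ)        ≈⟨ κ²D²≈ ⟨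
        κ * κ * (D * D)        ∎)

      far-error : fromℕ 3 * 𝔼² accepted ≤ 1#
      far-error = far-error-≤⅓ 0<m̂ (𝔼²-nonNeg accepted-nonNeg) 0≤D 1≤M M≤D² Mχ≤D² κD≈ (B≤ 0≤D Mχ≤D²) (begin
        μ * μ * 𝔼² accepted
          ≈⟨ 𝔼²-* (μ * μ) accepted ⟨
        𝔼² (λ xs ys → μ * μ * accepted xs ys)
          ≤⟨ 𝔼²-mono markov ⟩
        𝔼² (λ xs ys → fromℕ 4 * ((statistic xs ys - μ) * (statistic xs ys - μ)))
          ≈⟨ 𝔼²-* (fromℕ 4) _ ⟩
        fromℕ 4 * 𝔼² (λ xs ys → (statistic xs ys - μ) * (statistic xs ys - μ))
          ≤⟨ *-monoˡ-≤ (fromℕ-nonNeg 4) (≤-trans statistic-variance (+-monoʳ-≤ _ (*-monoˡ-≤ (square-nonNeg m̂) A≤))) ⟩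
        fromℕ 4 * (fromℕ 2 * (m̂ * m̂ * m̂ * B) + m̂ * m̂ * (M * (1# + χ))) ∎)
        where
        μ = m̂ * m̂ * χ
        0≤μ : 0# ≤ μ
        0≤μ = *-nonNeg (square-nonNeg m̂) 0≤χ
        markov : ∀ xs ys → μ * μ * accepted xs ys ≤ fromℕ 4 * ((statistic xs ys - μ) * (statistic xs ys - μ))
        markov xs ys with fromℕ 8 * statistic xs ys ≤? θ
        ... | no _     = ≤-respˡ (sym (zeroʳ _)) (*-nonNeg (fromℕ-nonNeg 4) (square-nonNeg _))
        ... | yes 8W≤θ = ≤-respˡ (sym (*-identityʳ _))
          (≤-respʳ (solve 2 (λ W μ → (:2 :* (μ :- W)) :* (:2 :* (μ :- W)) := :4 :* ((W :- μ) :* (W :- μ))) refl W μ)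
            (*-mono-≤ (≤-trans 0≤μ μ≤2[μ-W]) 0≤μ μ≤2[μ-W] μ≤2[μ-W]))
          where
          W = statistic xs ys
          8W≤4μ : fromℕ 8 * W ≤ fromℕ 4 * μ
          8W≤4μ = ≤-trans 8W≤θ (≤-respʳ
            (solve 2 (λ s χ → s :* (:4 :* χ) := :4 :* (s :* χ)) refl (m̂ * m̂) χ)
            (*-monoˡ-≤ (square-nonNeg m̂) ε²≤4χ))
          -- Acceptance keeps the statistic at or below half its mean, so it deviates from the mean
          -- by at least `μ / 2`.
          μ≤2[μ-W] : μ ≤ fromℕ 2 * (μ - W)
          μ≤2[μ-W] = *-cancelˡ-≤ (fromℕ-pos {4} (s≤s z≤n))
            (≤-by (≤⇒0≤y-x 8W≤4μ) (solve 2 (λ W μ → :4 :* (:2 :* (μ :- W)) := :4 :* μ :+ (:4 :* μ :- :n 8 :* W)) refl W μ))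

-- The program.

-- Integer cells: 0 holds n (at the end, the verdict), 1 and 2 count the samples
-- of the two batches, 3 ends up as N, 4 holds a coin, 5 a uniform point, 6 a
-- sample of q.  Real cells: 0 holds ε, 1 the statistic, and 2 + y the sum of
-- 1/a(x) over the samples x = y of the first batch.
unsaturated : Test
unsaturated = int[ lit 3 ] ⊕ lit 1 ≤ᵢ int[ lit 0 ]

double : Program
double = int[ lit 4 ]≔flip
       ∷ int[ lit 5 ]≔ int[ lit 5 ] ⊕ int[ lit 5 ] ⊕ int[ lit 4 ]
       ∷ int[ lit 3 ]≔ int[ lit 3 ] ⊕ int[ lit 3 ]
       ∷ []

doubling : Stmt
doubling = while unsaturated double

draw : Program → Program
draw P = int[ lit 3 ]≔ lit 1
       ∷ int[ lit 5 ]≔ lit 0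
       ∷ doubling
       ∷ int[ lit 6 ]≔sample
       ∷ int[ lit 4 ]≔flip
       ∷ P

-- The coin selects cell 5 or 6 by its address rather than by a branch.
drawn : IntExpr
drawn = int[ lit 5 ⊕ int[ lit 4 ] ]

-- The reciprocal of the smoothed mass. At padding points, from `n` to `N - 1`, the query returns 0,
-- so only the uniform half `1/(2N)` remains.
weight : IntExpr → RealExpr
weight x = cast (lit 1) ⊘ (cast (lit 1) ⊘ cast (lit 2) ⊠ (prob x ⊞ cast (lit 1) ⊘ cast int[ lit 3 ]))

-- The squared form of `m ε² ≤ 512 √n`, since 64³ = 512².
insufficient : Test
insufficient =
  cast int[ lit 1 ] ⊠ cast int[ lit 1 ] ⊠
    (real[ lit 0 ] ⊠ real[ lit 0 ] ⊠ (real[ lit 0 ] ⊠ real[ lit 0 ]))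
  ≤ᵣ cast (lit 64) ⊠ cast (lit 64) ⊠ cast (lit 64) ⊠ cast int[ lit 0 ]

collect : Program
collect = draw
  ( real[ lit 2 ⊕ drawn ]≔ weight drawn ⊞ real[ lit 2 ⊕ drawn ]
  ∷ int[ lit 1 ]≔ lit 1 ⊕ int[ lit 1 ]
  ∷ [])

collecting : Stmt
collecting = while insufficient collect

unscored : Test
unscored = int[ lit 2 ] ⊕ lit 1 ≤ᵢ int[ lit 1 ]

score : Program
score = draw
  -- Subtracting the size of the first batch accounts for the `- 1` of all pairs containing this
  -- sample at once.
  ( real[ lit 1 ]≔ (real[ lit 2 ⊕ drawn ] ⊟ cast int[ lit 1 ]) ⊞ real[ lit 1 ]
  ∷ int[ lit 2 ]≔ lit 1 ⊕ int[ lit 2 ]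
  ∷ [])

scoring : Stmt
scoring = while unscored score

deciding : Stmt
deciding = branch
  (cast (lit 8) ⊠ real[ lit 1 ] ≤ᵣ
     cast int[ lit 1 ] ⊠ cast int[ lit 1 ] ⊠ (real[ lit 0 ] ⊠ real[ lit 0 ]))
  (int[ lit 0 ]≔ lit 1 ∷ [])
  (int[ lit 0 ]≔ lit 0 ∷ [])

tester : Program
tester = collecting ∷ scoring ∷ deciding ∷ []

-- Step counts, with the steps of the continuation as last argument.
doublingSteps : ℕ → ℕ → ℕ
doublingSteps zero    t = suc t
doublingSteps (suc r) t = 4 ℕ.+ doublingSteps r t

drawSteps : ℕ → ℕ → ℕ
drawSteps k t = 2 ℕ.+ doublingSteps k (2 ℕ.+ t)

loopSteps : ℕ → ℕ → ℕ → ℕ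
loopSteps k zero    t = suc t
loopSteps k (suc r) t = suc (drawSteps k (2 ℕ.+ loopSteps k r t))

testerSteps : ℕ → ℕ → ℕ
testerSteps k m = loopSteps k m (loopSteps k m 2)

-- The law of a single draw.

module Execution {c ℓ₁ ℓ₂} (R : OrderedField c ℓ₁ ℓ₂)
  {n : ℕ} (p q : Distribution R n)
  (k : ℕ) (2^j<n : ∀ {j} → j ℕ.< k → 2 ℕ.^ j ℕ.< n) (n≤2^k : n ℕ.≤ 2 ℕ.^ k)
  (v : Verdict R)
  where

  open OrderedField R hiding (zero)
  open FieldProperties R
  open Sums R
  open ≤-Reasoning
  open import Algebra.Properties.Semiring.Sum semiring using (sum; sum-cong-≋)

  N : ℕ
  N = 2 ℕ.^ k

  ½ N⁻¹ : Carrier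
  ½ = fromℕ 2 ⁻¹
  N⁻¹ = fromℕ N ⁻¹

  -- The factors `fromℕ 1` copy the evaluation of the program's weight expression, whose inverse is
  -- thereby taken of literally the same term.
  smoothed : Distribution R n → ℕ → Carrier
  smoothed d i = fromℕ 1 * ½ * (query R d i + fromℕ 1 * N⁻¹)

  smoothed≈ : ∀ d i → smoothed d i ≈ ½ * (query R d i + N⁻¹)
  smoothed≈ d i = *-cong (trans (*-congʳ fromℕ-1) (*-identityˡ ½))
    (+-congˡ (trans (*-congʳ fromℕ-1) (*-identityˡ N⁻¹)))

  a b : ℕ → Carrier
  a = smoothed p
  b = smoothed q

  open Expectation R N b

  run-while : ∀ {B} t τ P Q s → evalTest R p s τ ≡ B →
    run R p q (suc t) (while τ P ∷ Q) s v ≡ run R p q t (if B then P ++ while τ P ∷ Q else Q) s v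
  run-while t τ P Q s ≡.refl = ≡.refl

  record Preserves (s s′ : State R) : Set c where
    constructor preserves
    field
      int-0 : ints s′ 0 ≡ ints s 0
      int-1 : ints s′ 1 ≡ ints s 1
      int-2 : ints s′ 2 ≡ ints s 2
      real  : reals s′ ≡ reals s

  -- The expectation of G at the number obtained by appending r random binary
  -- digits to u.
  bits : ℕ → (ℕ → Carrier) → ℕ → Carrier
  bits zero    G u = G u
  bits (suc r) G u = ½ * bits r G (u ℕ.+ u ℕ.+ 0) + ½ * bits r G (u ℕ.+ u ℕ.+ 1)

  ≤⇒≤ᵇ≡true : ∀ {i j} → i ℕ.≤ j → (i ℕ.≤ᵇ j) ≡ true
  ≤⇒≤ᵇ≡true {i} {j} i≤j with i ℕ.≤ᵇ j | ℕₚ.≤⇒≤ᵇ i≤j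
  ... | true | _ = ≡.refl

  ≰⇒≤ᵇ≡false : ∀ {i j} → ¬ (i ℕ.≤ j) → (i ℕ.≤ᵇ j) ≡ false
  ≰⇒≤ᵇ≡false {i} {j} i≰j with i ℕ.≤ᵇ j in eq
  ... | false = ≡.refl
  ... | true  = contradiction (ℕₚ.≤ᵇ⇒≤ i j (≡.subst T (≡.sym eq) tt)) i≰j

  -- With `a` rounds done, cell 3 holds `2 ^ a`. Minimality of `k` keeps the loop running while `a`
  -- is below `k`, and `n ≤ 2 ^ k` stops it at `k`. The coins thus affect cell 5 but never the
  -- number of steps.
  run-doubling : ∀ r a → a ℕ.+ r ≡ k → ∀ s u →
    ints s 0 ≡ n → ints s 3 ≡ 2 ℕ.^ a → ints s 5 ≡ u → ∀ t Q G →
    (∀ s′ u′ → Preserves s s′ → ints s′ 3 ≡ N → ints s′ 5 ≡ u′ → run R p q t Q s′ v ≈ G u′) →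
    run R p q (doublingSteps r t) (doubling ∷ Q) s v ≈ bits r G u
  run-doubling zero a a+0≡k s u i0 i3 i5 t Q G rest =
    trans (reflexive (run-while t unsaturated double Q s exit))
      (rest s u (preserves ≡.refl ≡.refl ≡.refl ≡.refl) i3≡N i5)
    where
    i3≡N : ints s 3 ≡ N
    i3≡N = ≡.trans i3 (≡.cong (2 ℕ.^_) (≡.trans (≡.sym (ℕₚ.+-identityʳ a)) a+0≡k))
    exit : (ints s 3 ℕ.+ 1 ℕ.≤ᵇ ints s 0) ≡ false
    exit rewrite i3≡N | i0 = ≰⇒≤ᵇ≡false λ N+1≤n →
      ℕₚ.<⇒≱ (≡.subst (ℕ._≤ n) (ℕₚ.+-comm N 1) N+1≤n) n≤2^k
  run-doubling (suc r) a a+r≡k s u i0 i3 i5 t Q G rest =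
    trans (reflexive (run-while (3 ℕ.+ doublingSteps r t) unsaturated double Q s go))
      (+-cong (*-congˡ (continue 0)) (*-congˡ (continue 1)))
    where
    go : (ints s 3 ℕ.+ 1 ℕ.≤ᵇ ints s 0) ≡ true
    go rewrite i3 | i0 = ≤⇒≤ᵇ≡true (≡.subst (ℕ._≤ n) (ℕₚ.+-comm 1 (2 ℕ.^ a))
      (2^j<n (≡.subst (a ℕ.<_) a+r≡k (ℕₚ.m<m+n a (s≤s z≤n)))))
    after : ℕ → State R
    after bit = setInt R (setInt R (setInt R s 4 bit) 5 (ints s 5 ℕ.+ ints s 5 ℕ.+ bit)) 3 (ints s 3 ℕ.+ ints s 3)
    continue : ∀ bit → run R p q (doublingSteps r t) (doubling ∷ Q) (after bit) v ≈ bits r G (u ℕ.+ u ℕ.+ bit)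
    continue bit = run-doubling r (suc a) (≡.trans (≡.sym (ℕₚ.+-suc a r)) a+r≡k) (after bit) _ i0
      (≡.trans (≡.cong₂ ℕ._+_ i3 i3) (≡.cong (2 ℕ.^ a ℕ.+_) (≡.sym (ℕₚ.+-identityʳ _))))
      (≡.cong (λ z → z ℕ.+ z ℕ.+ bit) i5) t Q G
      (λ { s′ u′ (preserves e₀ e₁ e₂ e₃) → rest s′ u′ (preserves e₀ e₁ e₂ e₃) })

  ½^ : ℕ → Carrier
  ½^ zero    = 1#
  ½^ (suc r) = ½ * ½^ r

  -- The numbers extending `u` by `r` digits form the block of length `2 ^ r` starting at
  -- `u * 2 ^ r`, and the first digit picks its lower or upper half.
  bits≈ : ∀ r G u → bits r G u ≈ ½^ r * ∑< (2 ℕ.^ r) (λ i → G (u ℕ.* 2 ℕ.^ r ℕ.+ i))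
  bits≈ zero G u = begin-equality
    G u                              ≡⟨ ≡.cong G (≡.sym (≡.trans (ℕₚ.+-identityʳ _) (ℕₚ.*-identityʳ u))) ⟩
    G (u ℕ.* 1 ℕ.+ 0)                ≈⟨ trans (*-identityˡ _) (trans (∑<-const 1 _) (trans (*-congʳ fromℕ-1) (*-identityˡ _))) ⟨
    1# * ∑< 1 (λ _ → G (u ℕ.* 1 ℕ.+ 0))  ≈⟨ *-congˡ (∑<-cong 1 λ { zero _ → refl ; (suc _) (s≤s ()) }) ⟩
    1# * ∑< 1 (λ i → G (u ℕ.* 1 ℕ.+ i)) ∎
  bits≈ (suc r) G u = begin-equality
    ½ * bits r G (u ℕ.+ u ℕ.+ 0) + ½ * bits r G (u ℕ.+ u ℕ.+ 1)
      ≈⟨ +-cong (*-congˡ (bits≈ r G _)) (*-congˡ (bits≈ r G _)) ⟩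
    ½ * (½^ r * ∑< M (λ i → G ((u ℕ.+ u ℕ.+ 0) ℕ.* M ℕ.+ i))) +
    ½ * (½^ r * ∑< M (λ i → G ((u ℕ.+ u ℕ.+ 1) ℕ.* M ℕ.+ i)))
      ≈⟨ +-cong (*-congˡ (*-congˡ (∑<-cong M (λ i _ → reflexive (≡.cong G (low i))))))
                (*-congˡ (*-congˡ (∑<-cong M (λ i _ → reflexive (≡.cong G (high i)))))) ⟩
    ½ * (½^ r * ∑< M (λ i → G (u ℕ.* (M ℕ.+ M) ℕ.+ i))) +
    ½ * (½^ r * ∑< M (λ i → G (u ℕ.* (M ℕ.+ M) ℕ.+ (M ℕ.+ i))))
      ≈⟨ solve 4 (λ h e x y → h :* (e :* x) :+ h :* (e :* y) := (h :* e) :* (x :+ y)) refl ½ (½^ r) _ _ ⟩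
    (½ * ½^ r) * (∑< M (λ i → G (u ℕ.* (M ℕ.+ M) ℕ.+ i)) + ∑< M (λ i → G (u ℕ.* (M ℕ.+ M) ℕ.+ (M ℕ.+ i))))
      ≈⟨ *-congˡ (∑<-split M M _) ⟨
    (½ * ½^ r) * ∑< (M ℕ.+ M) (λ i → G (u ℕ.* (M ℕ.+ M) ℕ.+ i))
      ≡⟨ ≡.cong (λ z → (½ * ½^ r) * ∑< z (λ i → G (u ℕ.* z ℕ.+ i))) (≡.cong (M ℕ.+_) (≡.sym (ℕₚ.+-identityʳ M))) ⟩
    (½ * ½^ r) * ∑< (2 ℕ.^ suc r) (λ i → G (u ℕ.* 2 ℕ.^ suc r ℕ.+ i)) ∎
    where
    M = 2 ℕ.^ r
    low-id : ∀ u M i → (u ℕ.+ u ℕ.+ 0) ℕ.* M ℕ.+ i ≡ u ℕ.* (M ℕ.+ M) ℕ.+ i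
    low-id = solve-∀
    high-id : ∀ u M i → (u ℕ.+ u ℕ.+ 1) ℕ.* M ℕ.+ i ≡ u ℕ.* (M ℕ.+ M) ℕ.+ (M ℕ.+ i)
    high-id = solve-∀
    low : ∀ i → (u ℕ.+ u ℕ.+ 0) ℕ.* M ℕ.+ i ≡ u ℕ.* (M ℕ.+ M) ℕ.+ i
    low = low-id u M
    high : ∀ i → (u ℕ.+ u ℕ.+ 1) ℕ.* M ℕ.+ i ≡ u ℕ.* (M ℕ.+ M) ℕ.+ (M ℕ.+ i)
    high = high-id u M

  1≤2^ : ∀ r → 1 ℕ.≤ 2 ℕ.^ r
  1≤2^ r = ℕₚ.m^n>0 2 r

  0<N : 0# < fromℕ N
  0<N = fromℕ-pos (1≤2^ k)

  NN⁻¹≈1 : fromℕ N * N⁻¹ ≈ 1#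
  NN⁻¹≈1 = *-inverseʳ _ (>⇒≉ 0<N)

  2½≈1 : fromℕ 2 * ½ ≈ 1#
  2½≈1 = *-inverseʳ _ (>⇒≉ (fromℕ-pos {2} (s≤s z≤n)))

  ½^≈ : ∀ r → fromℕ (2 ℕ.^ r) * ½^ r ≈ 1#
  ½^≈ zero    = trans (*-identityʳ _) fromℕ-1
  ½^≈ (suc r) = begin-equality
    fromℕ (2 ℕ.* 2 ℕ.^ r) * (½ * ½^ r)           ≈⟨ *-congʳ (fromℕ-* 2 (2 ℕ.^ r)) ⟩
    fromℕ 2 * fromℕ (2 ℕ.^ r) * (½ * ½^ r)       ≈⟨ solve 4 (λ t m h e → t :* m :* (h :* e) := (t :* h) :* (m :* e)) refl (fromℕ 2) _ ½ _ ⟩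
    (fromℕ 2 * ½) * (fromℕ (2 ℕ.^ r) * ½^ r)     ≈⟨ *-cong 2½≈1 (½^≈ r) ⟩
    1# * 1#                                      ≈⟨ *-identityʳ 1# ⟩
    1#                                           ∎

  bits-uniform : ∀ G → bits k G 0 ≈ N⁻¹ * ∑< N G
  bits-uniform G = trans (bits≈ k G 0)
    (*-congʳ (*-cancelˡ-≈ (>⇒≉ 0<N) (trans (½^≈ k) (sym NN⁻¹≈1))))

  query-toℕ : ∀ (d : Distribution R n) i → query R d (toℕ i) ≈ mass d i
  query-toℕ d i with toℕ i ℕₚ.<? n
  ... | yes i<n = reflexive (≡.cong (mass d) (fromℕ<-toℕ i i<n))
  ... | no  i≮n = contradiction (toℕ<n i) i≮n

  query-out : ∀ (d : Distribution R n) i → n ℕ.≤ i → query R d i ≈ 0#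
  query-out d i n≤i with i ℕₚ.<? n
  ... | yes i<n = contradiction n≤i (ℕₚ.<⇒≱ i<n)
  ... | no  _   = refl

  query-nonNeg : ∀ (d : Distribution R n) i → 0# ≤ query R d i
  query-nonNeg d i with i ℕₚ.<? n
  ... | yes i<n = nonNeg d _
  ... | no  _   = ≤-refl

  opaque
    unfolding ∑<

    sum≈∑< : ∀ (f : Fin n → Carrier) g → (∀ i → f i ≈ g (toℕ i)) → (∀ i → n ℕ.≤ i → g i ≈ 0#) →
             sum f ≈ ∑< N g
    sum≈∑< f g f≈g g≈0 = trans (sum-cong-≋ f≈g) (∑<-extend g n≤2^k g≈0)

  sum-mass : ∀ (d : Distribution R n) (f : ℕ → Carrier) →
    sum (λ i → mass d i * f (toℕ i)) ≈
    ∑< N (λ i → query R d i * f i)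
  sum-mass d f = sum≈∑< _ _ (λ i → *-congʳ (sym (query-toℕ d i)))
    (λ i n≤i → trans (*-congʳ (query-out d i n≤i)) (zeroˡ _))

  ∑query≈1 : ∀ (d : Distribution R n) → ∑< N (query R d) ≈ 1#
  ∑query≈1 d = trans (sym (sum≈∑< (mass d) _ (λ i → sym (query-toℕ d i)) (query-out d))) (total d)

  coin : (ℕ → Carrier) → ℕ → Carrier
  coin G u = sum (λ i → mass q i * (½ * G u + ½ * G (toℕ i)))

  -- For each outcome of the last coin, the point not selected is averaged out, its total
  -- probability being 1. What remains is half the uniform law plus half of `q`, which is `b`.
  mixture : ∀ G → bits k (coin G) 0 ≈ 𝔼 G
  mixture G = begin-equality
    bits k (coin G) 0
      ≈⟨ bits-uniform _ ⟩
    N⁻¹ * ∑< N (coin G)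
      ≈⟨ *-congˡ (∑<-cong N (λ u _ → sum-mass q (λ i → ½ * G u + ½ * G i))) ⟩
    N⁻¹ * ∑< N (λ u → ∑< N (λ i → query R q i * (½ * G u + ½ * G i)))
      ≈⟨ *-congˡ (∑<-cong N (λ u _ → inner u)) ⟩
    N⁻¹ * ∑< N (λ u → ½ * G u + ½ * S)
      ≈⟨ *-congˡ (trans (∑<-+ N _ _) (+-cong (∑<-* N ½ G) (∑<-const N _))) ⟩
    N⁻¹ * (½ * ∑< N G + fromℕ N * (½ * S))
      ≈⟨ solve 5 (λ i h g m s → i :* (h :* g :+ m :* (h :* s)) := h :* i :* g :+ (m :* i) :* (h :* s)) refl N⁻¹ ½ (∑< N G) (fromℕ N) S ⟩
    ½ * N⁻¹ * ∑< N G + (fromℕ N * N⁻¹) * (½ * S)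
      ≈⟨ +-congˡ (trans (*-congʳ NN⁻¹≈1) (*-identityˡ _)) ⟩
    ½ * N⁻¹ * ∑< N G + ½ * S
      ≈⟨ +-cong (∑<-* N _ _) (∑<-* N _ _) ⟨
    ∑< N (λ i → ½ * N⁻¹ * G i) + ∑< N (λ i → ½ * (query R q i * G i))
      ≈⟨ ∑<-+ N _ _ ⟨
    ∑< N (λ i → ½ * N⁻¹ * G i + ½ * (query R q i * G i))
      ≈⟨ ∑<-cong N (λ i _ → trans
           (solve 4 (λ h j g d → h :* j :* g :+ h :* (d :* g) := h :* (d :+ j) :* g) refl ½ N⁻¹ (G i) (query R q i))
           (*-congʳ (sym (smoothed≈ q i)))) ⟩
    ∑< N (λ i → b i * G i)
      ≈⟨ ∑≈𝔼 ⟩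
    𝔼 G ∎
    where
    S = ∑< N (λ i → query R q i * G i)
    opaque
      unfolding 𝔼
      ∑≈𝔼 : ∑< N (λ i → b i * G i) ≈ 𝔼 G
      ∑≈𝔼 = refl
    inner : ∀ u → ∑< N (λ i → query R q i * (½ * G u + ½ * G i)) ≈ ½ * G u + ½ * S
    inner u = begin-equality
      ∑< N (λ i → query R q i * (½ * G u + ½ * G i))
        ≈⟨ ∑<-cong N (λ i _ → solve 4 (λ h d g g′ → d :* (h :* g :+ h :* g′) := (h :* g) :* d :+ h :* (d :* g′)) refl ½ (query R q i) (G u) (G i)) ⟩
      ∑< N (λ i → (½ * G u) * query R q i + ½ * (query R q i * G i))
        ≈⟨ trans (∑<-+ N _ _) (+-cong (trans (∑<-* N _ _) (trans (*-congˡ (∑query≈1 q)) (*-identityʳ _))) (∑<-* N _ _)) ⟩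
      ½ * G u + ½ * S ∎

  run-draw : ∀ s → ints s 0 ≡ n → ∀ t Q G →
    (∀ s′ x → Preserves s s′ → ints s′ 3 ≡ N → ints s′ (5 ℕ.+ ints s′ 4) ≡ x → run R p q t Q s′ v ≈ G x) →
    run R p q (drawSteps k t) (draw Q) s v ≈ 𝔼 G
  run-draw s i0 t Q G rest = trans
    (run-doubling k 0 ≡.refl (setInt R (setInt R s 3 1) 5 0) 0 i0 ≡.refl ≡.refl (2 ℕ.+ t) _ (coin G) picked)
    (mixture G)
    where
    picked : ∀ s′ u → Preserves (setInt R (setInt R s 3 1) 5 0) s′ → ints s′ 3 ≡ N → ints s′ 5 ≡ u →
      run R p q (2 ℕ.+ t) (int[ lit 6 ]≔sample ∷ int[ lit 4 ]≔flip ∷ Q) s′ v ≈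
      coin G u
    picked s′ u (preserves e₀ e₁ e₂ e₃) i3 i5 = sum-cong-≋ {n} (λ i → *-congˡ (+-cong
      (*-congˡ (rest (setInt R (setInt R s′ 6 (toℕ i)) 4 0) u (preserves e₀ e₁ e₂ e₃) i3 i5))
      (*-congˡ (rest (setInt R (setInt R s′ 6 (toℕ i)) 4 1) (toℕ i) (preserves e₀ e₁ e₂ e₃) i3 ≡.refl))))

-- Invariants of the two sampling loops.

insufficientAt : ∀ {c ℓ₁ ℓ₂} (R : OrderedField c ℓ₁ ℓ₂) → ℕ → OrderedField.Carrier R → ℕ → Bool
insufficientAt R n ε m = ⌊ fromℕ m * fromℕ m * (ε * ε * (ε * ε)) ≤? fromℕ 64 * fromℕ 64 * fromℕ 64 * fromℕ n ⌋
  where open OrderedField R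

module Loops {c ℓ₁ ℓ₂} (R : OrderedField c ℓ₁ ℓ₂)
  {n : ℕ} (p q : Distribution R n)
  (k : ℕ) (2^j<n : ∀ {j} → j ℕ.< k → 2 ℕ.^ j ℕ.< n) (n≤2^k : n ℕ.≤ 2 ℕ.^ k)
  (v : Verdict R)
  where

  open OrderedField R hiding (zero)
  open FieldProperties R
  open Sums R
  open ≤-Reasoning
  open Execution R p q k 2^j<n n≤2^k v
  open Expectation R N b

  M : Carrier
  M = fromℕ 2 * fromℕ N

  0≤½ : 0# ≤ ½
  0≤½ = ⁻¹-nonNeg (fromℕ-pos {2} (s≤s z≤n))

  0≤N⁻¹ : 0# ≤ N⁻¹
  0≤N⁻¹ = ⁻¹-nonNeg 0<N

  smoothed-nonNeg : ∀ d i → 0# ≤ smoothed d i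
  smoothed-nonNeg d i = ≤-respʳ (sym (smoothed≈ d i))
    (*-nonNeg 0≤½ (+-nonNeg (query-nonNeg d i) 0≤N⁻¹))

  1≤M*smoothed : ∀ d i → 1# ≤ M * smoothed d i
  1≤M*smoothed d i = ≤-by (*-nonNeg (fromℕ-nonNeg N) (query-nonNeg d i)) (begin-equality
    M * smoothed d i
      ≈⟨ *-congˡ (smoothed≈ d i) ⟩
    fromℕ 2 * fromℕ N * (½ * (query R d i + N⁻¹))
      ≈⟨ solve 5 (λ t m h d j → t :* m :* (h :* (d :+ j)) := (t :* h) :* (m :* j :+ m :* d)) refl (fromℕ 2) (fromℕ N) ½ (query R d i) N⁻¹ ⟩
    (fromℕ 2 * ½) * (fromℕ N * N⁻¹ + fromℕ N * query R d i)
      ≈⟨ trans (*-cong 2½≈1 (+-congʳ NN⁻¹≈1)) (*-identityˡ _) ⟩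
    1# + fromℕ N * query R d i ∎)

  smoothed-pos : ∀ d i → 0# < smoothed d i
  smoothed-pos d i = smoothed-nonNeg d i , λ 0≈a →
    >⇒≉ 0<1 (antisym (≤-respʳ (trans (*-congˡ (sym 0≈a)) (zeroʳ M)) (1≤M*smoothed d i)) 0≤1)

  ∑smoothed≈1 : ∀ d → ∑< N (smoothed d) ≈ 1#
  ∑smoothed≈1 d = begin-equality
    ∑< N (smoothed d)                            ≈⟨ ∑<-cong N (λ i _ → smoothed≈ d i) ⟩
    ∑< N (λ i → ½ * (query R d i + N⁻¹))         ≈⟨ trans (∑<-* N _ _) (*-congˡ (∑<-+ N _ _)) ⟩
    ½ * (∑< N (query R d) + ∑< N (λ _ → N⁻¹))    ≈⟨ *-congˡ (+-cong (∑query≈1 d) (trans (∑<-const N _) NN⁻¹≈1)) ⟩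
    ½ * (1# + 1#)                                ≈⟨ solve 1 (λ h → h :* (:1 :+ :1) := :2 :* h) refl ½ ⟩
    fromℕ 2 * ½                                  ≈⟨ 2½≈1 ⟩
    1#                                           ∎

  1≤M : 1# ≤ M
  1≤M = ≤-respʳ (fromℕ-* 2 N) (1≤fromℕ (ℕₚ.*-mono-≤ {1} {2} (s≤s z≤n) (1≤2^ k)))

  -- By minimality of `k`, half of `N` is still below `n`, unless `N` is 1.
  N≤2n : 1 ℕ.≤ n → N ℕ.≤ 2 ℕ.* n
  N≤2n 1≤n = helper k 2^j<n
    where
    helper : ∀ k → (∀ {j} → j ℕ.< k → 2 ℕ.^ j ℕ.< n) → 2 ℕ.^ k ℕ.≤ 2 ℕ.* n
    helper zero    _     = ℕₚ.*-mono-≤ {1} {2} (s≤s z≤n) 1≤n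
    helper (suc j) 2^j<n = ℕₚ.*-monoʳ-≤ 2 (ℕₚ.<⇒≤ (2^j<n ℕₚ.≤-refl))

  M≤4n : 1 ℕ.≤ n → M ≤ fromℕ 4 * fromℕ n
  M≤4n 1≤n = begin
    fromℕ 2 * fromℕ N              ≤⟨ *-monoˡ-≤ (fromℕ-nonNeg 2) (fromℕ-mono-≤ (N≤2n 1≤n)) ⟩
    fromℕ 2 * fromℕ (2 ℕ.* n)      ≈⟨ *-congˡ (fromℕ-* 2 n) ⟩
    fromℕ 2 * (fromℕ 2 * fromℕ n)  ≈⟨ solve 1 (λ n → :2 :* (:2 :* n) := :4 :* n) refl (fromℕ n) ⟩
    fromℕ 4 * fromℕ n              ∎

  open ChiSquare R N a b M (smoothed-pos p) (smoothed-nonNeg q) (∑smoothed≈1 p) (∑smoothed≈1 q)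
    (1≤M*smoothed p) public using (w; K; module Deviation)

  table : List ℕ → ℕ → Carrier
  table xs y = ∑ᴸ (λ x → if x ℕ.≡ᵇ y then w x else 0#) xs

  -- This identity lets one memory access replace a pass over the first batch for each sample of the
  -- second.
  ∑K≈table : ∀ xs y → ∑ᴸ (λ x → K x y) xs ≈ table xs y - fromℕ (length xs)
  ∑K≈table []       y = sym (-‿inverseʳ 0#)
  ∑K≈table (x ∷ xs) y = trans (+-congˡ (∑K≈table xs y))
    (solve 3 (λ e s l → (e :- :1) :+ (s :- l) := (e :+ s) :- (:1 :+ l)) refl
      (if x ℕ.≡ᵇ y then w x else 0#) (table xs y) (fromℕ (length xs)))

  module _ (ε : Carrier) (m : ℕ) where

    open Deviation m

    -- Cells that enter loop tests are tracked up to `≡`, which fixes the control flow; the table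
    -- entries are sums of weights and are known up to `≈` only.
    record Collected (s : State R) (xs : List ℕ) : Set (c ⊔ ℓ₁) where
      constructor collected
      field
        int-0  : ints s 0 ≡ n
        int-1  : ints s 1 ≡ length xs
        int-2  : ints s 2 ≡ 0
        real-0 : reals s 0 ≡ ε
        real-1 : reals s 1 ≡ 0#
        real-2 : ∀ y → reals s (2 ℕ.+ y) ≈ table xs y

    record Scored (s : State R) (xs ys : List ℕ) : Set (c ⊔ ℓ₁) where
      constructor scored
      field
        int-0  : ints s 0 ≡ n
        int-1  : ints s 1 ≡ m
        int-2  : ints s 2 ≡ length ys
        real-0 : reals s 0 ≡ ε
        real-1 : reals s 1 ≈ statistic xs ys
        real-2 : ∀ y → reals s (2 ℕ.+ y) ≈ table xs y

    insufficient≡ : ∀ {s xs} → Collected s xs → evalTest R p s insufficient ≡ insufficientAt R n ε (length xs)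
    insufficient≡ (collected i0 i1 _ r0 _ _) rewrite i0 | i1 | r0 = ≡.refl

    weight≈ : ∀ s x → ints s 3 ≡ N → ints s (5 ℕ.+ ints s 4) ≡ x → evalReal R p s (weight drawn) ≈ w x
    weight≈ s x i3 drawn≡x = trans
      (reflexive (≡.cong₂ (λ x N → fromℕ 1 * (fromℕ 1 * ½ * (query R p x + fromℕ 1 * fromℕ N ⁻¹)) ⁻¹) drawn≡x i3))
      (trans (*-congʳ fromℕ-1) (*-identityˡ _))

    update-table : ∀ (f : ℕ → Carrier) xs x z → (∀ y → f (2 ℕ.+ y) ≈ table xs y) → z ≈ w x + f (2 ℕ.+ x) →
      ∀ y → update R f (2 ℕ.+ x) z (2 ℕ.+ y) ≈ table (x ∷ xs) y
    update-table f xs x z f≈ z≈ y with x ℕ.≡ᵇ y in eq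
    ... | false = trans (f≈ y) (sym (+-identityˡ _))
    ... | true  = trans z≈ (+-congˡ (trans (f≈ x) (reflexive (≡.cong (table xs) x≡y))))
      where
      x≡y : x ≡ y
      x≡y = ℕₚ.≡ᵇ⇒≡ x y (≡.subst T (≡.sym eq) tt)

    module _ (more : ∀ {j} → j ℕ.< m → insufficientAt R n ε j ≡ true) (enough : insufficientAt R n ε m ≡ false) where

      -- The loop test depends on the samples only through their number, so `r` more rounds follow
      -- whatever is drawn, and each round contributes one `𝔼` through `run-draw`.
      run-collecting : ∀ r xs s → Collected s xs → length xs ℕ.+ r ≡ m → ∀ t Q F →
        (∀ s′ xs′ → Collected s′ xs′ → length xs′ ≡ m → run R p q t Q s′ v ≈ F xs′) →
        run R p q (loopSteps k r t) (collecting ∷ Q) s v ≈ 𝔼^ r F xs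
      run-collecting zero xs s inv l+0≡m t Q F rest = trans
        (reflexive (run-while t insufficient collect Q s
          (≡.trans (insufficient≡ inv) (≡.trans (≡.cong (insufficientAt R n ε) l≡m) enough))))
        (rest s xs inv l≡m)
        where
        l≡m : length xs ≡ m
        l≡m = ≡.trans (≡.sym (ℕₚ.+-identityʳ _)) l+0≡m
      run-collecting (suc r) xs s inv@(collected i0 i1 i2 r0 r1 r2) l+r≡m t Q F rest = trans
        (reflexive (run-while (drawSteps k (2 ℕ.+ loopSteps k r t)) insufficient collect Q s
          (≡.trans (insufficient≡ inv) (more (≡.subst (length xs ℕ.<_) l+r≡m (ℕₚ.m<m+n _ (s≤s z≤n)))))))
        (run-draw s i0 _ _ _ λ { s′ x pres i3 drawn≡x →
          run-collecting r (x ∷ xs) (next s′) (next-inv s′ x pres i3 drawn≡x)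
            (≡.trans (≡.sym (ℕₚ.+-suc _ r)) l+r≡m) t Q F rest })
        where
        next : State R → State R
        next s′ = setInt R
          (setReal R s′ (2 ℕ.+ ints s′ (5 ℕ.+ ints s′ 4))
            (evalReal R p s′ (weight drawn) + reals s′ (2 ℕ.+ ints s′ (5 ℕ.+ ints s′ 4))))
          1 (1 ℕ.+ ints s′ 1)
        next-inv : ∀ s′ x → Preserves s s′ → ints s′ 3 ≡ N → ints s′ (5 ℕ.+ ints s′ 4) ≡ x → Collected (next s′) (x ∷ xs)
        next-inv s′ x (preserves e0 e1 e2 ≡.refl) i3 ≡.refl = collected
          (≡.trans e0 i0) (≡.cong suc (≡.trans e1 i1)) (≡.trans e2 i2) r0 r1
          (update-table (reals s′) xs x _ r2 (+-congʳ (weight≈ s′ x i3 ≡.refl)))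

      run-scoring : ∀ r xs ys s → Scored s xs ys → length xs ≡ m → length ys ℕ.+ r ≡ m → ∀ t Q F →
        (∀ s′ ys′ → Scored s′ xs ys′ → run R p q t Q s′ v ≈ F ys′) →
        run R p q (loopSteps k r t) (scoring ∷ Q) s v ≈ 𝔼^ r F ys
      run-scoring zero xs ys s inv@(scored i0 i1 i2 _ _ _) |xs|≡m l+0≡m t Q F rest = trans
        (reflexive (run-while t unscored score Q s exit)) (rest s ys inv)
        where
        exit : (ints s 2 ℕ.+ 1 ℕ.≤ᵇ ints s 1) ≡ false
        exit rewrite i1 | i2 = ≰⇒≤ᵇ≡false λ l+1≤m →
          ℕₚ.<⇒≱ (≡.subst (ℕ._≤ m) (ℕₚ.+-comm _ 1) l+1≤m) (ℕₚ.≤-reflexive (≡.trans (≡.sym l+0≡m) (ℕₚ.+-identityʳ _)))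
      run-scoring (suc r) xs ys s (scored i0 i1 i2 r0 r1 r2) |xs|≡m l+r≡m t Q F rest = trans
        (reflexive (run-while (drawSteps k (2 ℕ.+ loopSteps k r t)) unscored score Q s go))
        (run-draw s i0 _ _ _ λ { s′ y pres i3 drawn≡y →
          run-scoring r xs (y ∷ ys) (next s′) (next-inv s′ y pres i3 drawn≡y) |xs|≡m
            (≡.trans (≡.sym (ℕₚ.+-suc _ r)) l+r≡m) t Q F rest })
        where
        go : (ints s 2 ℕ.+ 1 ℕ.≤ᵇ ints s 1) ≡ true
        go rewrite i1 | i2 = ≤⇒≤ᵇ≡true (≡.subst (ℕ._≤ m) (ℕₚ.+-comm 1 _)
          (≡.subst (length ys ℕ.<_) l+r≡m (ℕₚ.m<m+n _ (s≤s z≤n))))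
        next : State R → State R
        next s′ = setInt R
          (setReal R s′ 1 ((reals s′ (2 ℕ.+ ints s′ (5 ℕ.+ ints s′ 4)) - fromℕ (ints s′ 1)) + reals s′ 1))
          2 (1 ℕ.+ ints s′ 2)
        next-inv : ∀ s′ y → Preserves s s′ → ints s′ 3 ≡ N → ints s′ (5 ℕ.+ ints s′ 4) ≡ y → Scored (next s′) xs (y ∷ ys)
        next-inv s′ y (preserves e0 e1 e2 ≡.refl) i3 ≡.refl = scored
          (≡.trans e0 i0) (≡.trans e1 i1) (≡.cong suc (≡.trans e2 i2)) r0
          (+-cong (trans (+-cong (r2 y) (-‿cong (reflexive (≡.cong fromℕ (≡.trans e1 (≡.trans i1 (≡.sym |xs|≡m)))))))
                    (sym (∑K≈table xs y))) r1)
          r2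

      passed : List ℕ → List ℕ → Bool
      passed xs ys = ⌊ fromℕ 8 * statistic xs ys ≤? m̂ * m̂ * (ε * ε) ⌋

      outcome : Bool → Carrier
      outcome e = indicator R (if e then accept else reject) v

      ≤?-cong : ∀ {x x′ y} → x ≈ x′ → ⌊ x ≤? y ⌋ ≡ ⌊ x′ ≤? y ⌋
      ≤?-cong {x} {x′} {y} x≈x′ with x ≤? y | x′ ≤? y
      ... | yes _   | yes _    = ≡.refl
      ... | no  _   | no  _    = ≡.refl
      ... | yes x≤y | no  x′≰y = contradiction (≤-respˡ x≈x′ x≤y) x′≰y
      ... | no  x≰y | yes x′≤y = contradiction (≤-respˡ (sym x≈x′) x′≤y) x≰y

      run-deciding : ∀ s xs ys → Scored s xs ys → run R p q 2 (deciding ∷ []) s v ≈ outcome (passed xs ys)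
      run-deciding s xs ys (scored i0 i1 i2 r0 r1 r2) = reflexive (≡.trans branches (≡.cong outcome test≡))
        where
        θ-test : Test
        θ-test = cast (lit 8) ⊠ real[ lit 1 ] ≤ᵣ
          cast int[ lit 1 ] ⊠ cast int[ lit 1 ] ⊠ (real[ lit 0 ] ⊠ real[ lit 0 ])
        test≡ : evalTest R p s θ-test ≡ passed xs ys
        test≡ rewrite i1 | r0 = ≤?-cong (*-congˡ r1)
        branches : run R p q 2 (deciding ∷ []) s v ≡ outcome (evalTest R p s θ-test)
        branches with evalTest R p s θ-test
        ... | true  = ≡.refl
        ... | false = ≡.refl

      run-tester : run R p q (testerSteps k m) tester (initial R n ε) v ≈
                   𝔼² (λ xs ys → outcome (passed xs ys))
      run-tester = run-collecting m [] (initial R n ε)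
        (collected ≡.refl ≡.refl ≡.refl ≡.refl ≡.refl (λ _ → refl)) ≡.refl
        (loopSteps k m 2) (scoring ∷ deciding ∷ []) _
        λ { s xs (collected i0 i1 i2 r0 r1 r2) |xs|≡m →
          run-scoring m xs [] s (scored i0 (≡.trans i1 |xs|≡m) i2 r0 (reflexive r1) r2) |xs|≡m ≡.refl
            2 (deciding ∷ []) (λ ys → outcome (passed xs ys)) (λ s′ ys → run-deciding s′ xs ys) }

-- Bounded search, and the number of coin flips per draw.

leastFalse : (ℕ → Bool) → ℕ → ℕ
leastFalse f zero    = 0
leastFalse f (suc b) = if f 0 then suc (leastFalse (λ j → f (suc j)) b) else 0

leastFalse-below : ∀ (f : ℕ → Bool) b {j} → j ℕ.< leastFalse f b → f j ≡ true
leastFalse-below f (suc b) {j} j< with f 0 in eq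
leastFalse-below f (suc b) {zero}  _        | true = eq
leastFalse-below f (suc b) {suc j} (s≤s j<) | true = leastFalse-below (λ j → f (suc j)) b j<

-- The search returns its bound when `f` holds everywhere below it, so falsity at the bound is
-- enough.
leastFalse-at : ∀ (f : ℕ → Bool) b → f b ≡ false → f (leastFalse f b) ≡ false
leastFalse-at f zero    fb = fb
leastFalse-at f (suc b) fb with f 0 in eq
... | true  = leastFalse-at (λ j → f (suc j)) b fb
... | false = eq

rounds : ℕ → ℕ
rounds n = leastFalse (λ j → 2 ℕ.^ j ℕ.<ᵇ n) n

n<2^n : ∀ n → n ℕ.< 2 ℕ.^ n
n<2^n zero    = s≤s z≤n
n<2^n (suc n) = ≡.subst (suc (suc n) ℕ.≤_) (≡.cong (2 ℕ.^ n ℕ.+_) (≡.sym (ℕₚ.+-identityʳ _)))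
  (ℕₚ.+-mono-≤ (ℕₚ.m^n>0 2 n) (n<2^n n))

2^j<n : ∀ n {j} → j ℕ.< rounds n → 2 ℕ.^ j ℕ.< n
2^j<n n {j} j<k = ℕₚ.<ᵇ⇒< (2 ℕ.^ j) n
  (≡.subst T (≡.sym (leastFalse-below (λ j → 2 ℕ.^ j ℕ.<ᵇ n) n j<k)) tt)

≮ᵇ⇒≥ : ∀ {m n} → (m ℕ.<ᵇ n) ≡ false → n ℕ.≤ m
≮ᵇ⇒≥ {m} {n} eq = ℕₚ.≮⇒≥ λ m<n → ≡.subst T eq (ℕₚ.<⇒<ᵇ m<n)

≥⇒≮ᵇ : ∀ {m n} → n ℕ.≤ m → (m ℕ.<ᵇ n) ≡ false
≥⇒≮ᵇ {m} {n} n≤m with m ℕ.<ᵇ n in eq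
... | false = ≡.refl
... | true  = contradiction n≤m (ℕₚ.<⇒≱ (ℕₚ.<ᵇ⇒< m n (≡.subst T (≡.sym eq) tt)))

n≤2^rounds : ∀ n → n ℕ.≤ 2 ℕ.^ rounds n
n≤2^rounds n = ≮ᵇ⇒≥ (leastFalse-at (λ j → 2 ℕ.^ j ℕ.<ᵇ n) n (≥⇒≮ᵇ (ℕₚ.<⇒≤ (n<2^n n))))

-- If the least exponent is `suc j`, then `2 ^ j` is still below `n`, so `j` is at most the
-- logarithm.
rounds≤1+log : ∀ n → rounds n ℕ.≤ 1 ℕ.+ ⌊log₂ n ⌋
rounds≤1+log n with rounds n | 2^j<n n
... | zero  | _    = z≤n
... | suc j | 2^<n = s≤s (≡.subst (ℕ._≤ ⌊log₂ n ⌋) (⌊log₂[2^n]⌋≡n j)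
  (⌊log₂⌋-mono-≤ (ℕₚ.<⇒≤ (2^<n ℕₚ.≤-refl))))

-- Step counts in closed form.

doublingSteps≡ : ∀ k t → doublingSteps k t ≡ 4 ℕ.* k ℕ.+ 1 ℕ.+ t
doublingSteps≡ zero    t = ≡.refl
doublingSteps≡ (suc k) t = ≡.trans (≡.cong (4 ℕ.+_) (doublingSteps≡ k t)) (identity k t)
  where
  identity : ∀ k t → 4 ℕ.+ (4 ℕ.* k ℕ.+ 1 ℕ.+ t) ≡ 4 ℕ.* suc k ℕ.+ 1 ℕ.+ t
  identity = solve-∀

-- A round costs one loop test, two resets, `4k + 1` steps of doubling, a sample, a flip and two
-- assignments: `4k + 8` in all.
loopSteps≡ : ∀ k r t → loopSteps k r t ≡ r ℕ.* (4 ℕ.* k ℕ.+ 8) ℕ.+ 1 ℕ.+ t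
loopSteps≡ k zero    t = ≡.refl
loopSteps≡ k (suc r) t = ≡.trans
  (≡.cong (3 ℕ.+_) (≡.trans (doublingSteps≡ k _)
    (≡.cong (λ z → 4 ℕ.* k ℕ.+ 1 ℕ.+ (4 ℕ.+ z)) (loopSteps≡ k r t))))
  (identity k r t)
  where
  identity : ∀ k r t → 3 ℕ.+ (4 ℕ.* k ℕ.+ 1 ℕ.+ (4 ℕ.+ (r ℕ.* (4 ℕ.* k ℕ.+ 8) ℕ.+ 1 ℕ.+ t))) ≡
    suc r ℕ.* (4 ℕ.* k ℕ.+ 8) ℕ.+ 1 ℕ.+ t
  identity = solve-∀

-- The exact count is `8mk + 16m + 4`. Replacing `k` and 1 by `l` gives the 24 as 8 + 16, and the
-- final 4 is absorbed by passing to `m + 1`.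
testerSteps≤ : ∀ {k l} m → k ℕ.≤ l → 1 ℕ.≤ l → testerSteps k m ℕ.≤ 24 ℕ.* (suc m ℕ.* l)
testerSteps≤ {k} {l} m k≤l 1≤l = begin
  loopSteps k m (loopSteps k m 2)
    ≡⟨ ≡.trans (loopSteps≡ k m _) (≡.cong (m ℕ.* (4 ℕ.* k ℕ.+ 8) ℕ.+ 1 ℕ.+_) (loopSteps≡ k m 2)) ⟩
  m ℕ.* (4 ℕ.* k ℕ.+ 8) ℕ.+ 1 ℕ.+ (m ℕ.* (4 ℕ.* k ℕ.+ 8) ℕ.+ 1 ℕ.+ 2)
    ≡⟨ identity₁ k m ⟩
  8 ℕ.* (m ℕ.* k) ℕ.+ 16 ℕ.* (m ℕ.* 1) ℕ.+ 4 ℕ.* 1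
    ≤⟨ ℕₚ.+-mono-≤ (ℕₚ.+-mono-≤ (ℕₚ.*-monoʳ-≤ 8 (ℕₚ.*-monoʳ-≤ m k≤l)) (ℕₚ.*-monoʳ-≤ 16 (ℕₚ.*-monoʳ-≤ m 1≤l)))
         (ℕₚ.*-mono-≤ (ℕₚ.m≤m+n 4 20) 1≤l) ⟩
  8 ℕ.* (m ℕ.* l) ℕ.+ 16 ℕ.* (m ℕ.* l) ℕ.+ 24 ℕ.* l
    ≡⟨ identity₂ m l ⟩
  24 ℕ.* (suc m ℕ.* l) ∎
  where
  open ℕₚ.≤-Reasoning
  identity₁ : ∀ k m → m ℕ.* (4 ℕ.* k ℕ.+ 8) ℕ.+ 1 ℕ.+ (m ℕ.* (4 ℕ.* k ℕ.+ 8) ℕ.+ 1 ℕ.+ 2) ≡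
    8 ℕ.* (m ℕ.* k) ℕ.+ 16 ℕ.* (m ℕ.* 1) ℕ.+ 4 ℕ.* 1
  identity₁ = solve-∀
  identity₂ : ∀ m l → 8 ℕ.* (m ℕ.* l) ℕ.+ 16 ℕ.* (m ℕ.* l) ℕ.+ 24 ℕ.* l ≡ 24 ℕ.* (suc m ℕ.* l)
  identity₂ = solve-∀

-- Correctness of the tester.

module IdentityTester {c ℓ₁ ℓ₂} (R : OrderedField c ℓ₁ ℓ₂) where

  open OrderedField R hiding (zero)
  open FieldProperties R
  open Sums R
  open ≤-Reasoning
  open import Algebra.Properties.Semiring.Sum semiring using (sum; ∑-distrib-+)

  ⌊≤?⌋-true : ∀ {x y} → ⌊ x ≤? y ⌋ ≡ true → x ≤ y
  ⌊≤?⌋-true {x} {y} _ with x ≤? y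
  ⌊≤?⌋-true _ | yes x≤y = x≤y

  ⌊≤?⌋-false : ∀ {x y} → ⌊ x ≤? y ⌋ ≡ false → y ≤ x
  ⌊≤?⌋-false {x} {y} _ with x ≤? y
  ⌊≤?⌋-false _ | no x≰y = ≰⇒≥ x≰y

  -- A search limit only: the Archimedean property bounds `64³n/ε⁴` by some `B`, and at `m = B + 1`
  -- the test fails because `m² ≥ m > B`. The running time rests on minimality of the count found,
  -- not on this limit.
  sampleBound : ℕ → Carrier → ℕ
  sampleBound n ε = suc (proj₁ (archimedean
    (fromℕ 64 * fromℕ 64 * fromℕ 64 * fromℕ n * (ε ⁻¹ * ε ⁻¹ * (ε ⁻¹ * ε ⁻¹)))))

  samples : ℕ → Carrier → ℕ
  samples n ε = leastFalse (insufficientAt R n ε) (sampleBound n ε)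

  time : ℕ → Carrier → ℕ
  time n ε = testerSteps (rounds n) (samples n ε)

  module _ {ε} (0<ε : 0# < ε) where

    e : Carrier
    e = ε ⁻¹

    0≤e : 0# ≤ e
    0≤e = ⁻¹-nonNeg 0<ε

    ε⁴e⁴≈1 : ε * ε * (ε * ε) * (e * e * (e * e)) ≈ 1#
    ε⁴e⁴≈1 = trans
      (solve 2 (λ x y → x :* x :* (x :* x) :* (y :* y :* (y :* y)) := (x :* y) :* (x :* y) :* ((x :* y) :* (x :* y))) refl ε e)
      (trans (*-cong (*-cong εe≈1 εe≈1) (*-cong εe≈1 εe≈1)) (solve 0 (:1 :* :1 :* (:1 :* :1) := :1) refl))
      where εe≈1 = *-inverseʳ ε (>⇒≉ 0<ε)

    m²≤ : ∀ {m x} → fromℕ m * fromℕ m * (ε * ε * (ε * ε)) ≤ x → fromℕ m * fromℕ m ≤ x * (e * e * (e * e))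
    m²≤ {m} {x} m²ε⁴≤x = begin
      fromℕ m * fromℕ m
        ≈⟨ trans (sym (*-identityʳ _)) (*-congˡ (sym ε⁴e⁴≈1)) ⟩
      fromℕ m * fromℕ m * (ε * ε * (ε * ε) * (e * e * (e * e)))
        ≈⟨ *-assoc _ _ _ ⟨
      fromℕ m * fromℕ m * (ε * ε * (ε * ε)) * (e * e * (e * e))
        ≤⟨ *-monoʳ-≤ (*-nonNeg (square-nonNeg e) (square-nonNeg e)) m²ε⁴≤x ⟩
      x * (e * e * (e * e)) ∎

    samples-more : ∀ n {j} → j ℕ.< samples n ε → insufficientAt R n ε j ≡ true
    samples-more n = leastFalse-below (insufficientAt R n ε) (sampleBound n ε)

    samples-enough : ∀ n → insufficientAt R n ε (samples n ε) ≡ false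
    samples-enough n = leastFalse-at (insufficientAt R n ε) (sampleBound n ε) at-bound
      where
      x = fromℕ 64 * fromℕ 64 * fromℕ 64 * fromℕ n
      B = proj₁ (archimedean (x * (e * e * (e * e))))
      1+B≰B : ¬ (fromℕ (suc B) ≤ fromℕ B)
      1+B≰B 1+B≤B = >⇒≉ 0<1 (antisym
        (≤-by (≤⇒0≤y-x 1+B≤B) (solve 1 (λ B → :0 := :1 :+ (B :- (:1 :+ B))) refl (fromℕ B))) 0≤1)
      at-bound : insufficientAt R n ε (suc B) ≡ false
      at-bound with fromℕ (suc B) * fromℕ (suc B) * (ε * ε * (ε * ε)) ≤? x
      ... | no _ = ≡.refl
      ... | yes small = contradiction (begin
        fromℕ (suc B)                    ≈⟨ *-identityʳ _ ⟨
        fromℕ (suc B) * 1#               ≤⟨ *-monoˡ-≤ (fromℕ-nonNeg (suc B)) (1≤fromℕ {suc B} (s≤s z≤n)) ⟩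
        fromℕ (suc B) * fromℕ (suc B)    ≤⟨ m²≤ {suc B} small ⟩
        x * (e * e * (e * e))            ≤⟨ proj₂ (archimedean _) ⟩
        fromℕ B                          ∎) 1+B≰B

  module _ {n} (1≤n : 1 ℕ.≤ n) {ε} (0<ε : 0# < ε) (p q : Distribution R n) where

    k m : ℕ
    k = rounds n
    m = samples n ε

    open Execution R p q k (2^j<n n) (n≤2^rounds n) accept
    module L v = Loops R p q k (2^j<n n) (n≤2^rounds n) v
    open L accept
    open Threshold R N a b M (smoothed-pos p) (smoothed-nonNeg q) (∑smoothed≈1 p) (∑smoothed≈1 q)
      (1≤M*smoothed p) 1≤M m (fromℕ n) (fromℕ 64) ε (fromℕ-pos 1≤n) ≤-refl 0<ε (M≤4n 1≤n)
      -- The failed loop test is read backwards: it supplies the lower bound on the sample size,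
      -- with `κ` equal to 64.
      (⌊≤?⌋-false (samples-enough 0<ε n))
    open Deviation m

    Pr : Verdict R → Carrier
    Pr v = run R p q (time n ε) tester (initial R n ε) v

    Pr-accept : Pr accept ≈ 𝔼² accepted
    Pr-accept = trans (L.run-tester accept ε m (samples-more 0<ε n) (samples-enough 0<ε n))
      (𝔼²-cong λ xs ys → reflexive (outcome≡ (passes xs ys)))
      where
      outcome≡ : ∀ e → indicator R (if e then accept else reject) accept ≡ (if e then 1# else 0#)
      outcome≡ true  = ≡.refl
      outcome≡ false = ≡.refl

    Pr-reject : Pr reject ≈ 𝔼² rejected
    Pr-reject = trans (L.run-tester reject ε m (samples-more 0<ε n) (samples-enough 0<ε n))
      (𝔼²-cong λ xs ys → reflexive (outcome≡ (passes xs ys)))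
      where
      outcome≡ : ∀ e → indicator R (if e then accept else reject) reject ≡ (if e then 0# else 1#)
      outcome≡ true  = ≡.refl
      outcome≡ false = ≡.refl

    Pr-total : Pr accept + Pr reject ≈ 1#
    Pr-total = begin-equality
      Pr accept + Pr reject                              ≈⟨ +-cong Pr-accept Pr-reject ⟩
      𝔼² accepted + 𝔼² rejected                          ≈⟨ 𝔼²-+ accepted rejected ⟨
      𝔼² (λ xs ys → accepted xs ys + rejected xs ys)     ≈⟨ 𝔼²-cong one ⟩
      𝔼² (λ _ _ → 1#)                                    ≈⟨ 𝔼²-const 1# ⟩
      1#                                                 ∎
      where
      one : ∀ xs ys → accepted xs ys + rejected xs ys ≈ 1#
      one xs ys with passes xs ys
      ... | true  = +-identityʳ 1#
      ... | false = +-identityˡ 1#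

    ⅔≤ : ∀ {x y} → x + y ≈ 1# → fromℕ 3 * y ≤ 1# → ⅔ R ≤ x
    ⅔≤ {x} {y} x+y≈1 3y≤1 = *-cancelˡ-≤ 0<3 (begin
      fromℕ 3 * (fromℕ 2 * fromℕ 3 ⁻¹)
        ≈⟨ solve 3 (λ a b i → a :* (b :* i) := b :* (a :* i)) refl (fromℕ 3) (fromℕ 2) (fromℕ 3 ⁻¹) ⟩
      fromℕ 2 * (fromℕ 3 * fromℕ 3 ⁻¹)
        ≈⟨ *-congˡ (*-inverseʳ _ (>⇒≉ 0<3)) ⟩
      fromℕ 2 * 1#
        ≤⟨ ≤-by (≤⇒0≤y-x 3y≤1) (solve 1 (λ y → :n 3 :* (:1 :- y) := :2 :* :1 :+ (:1 :- :n 3 :* y)) refl y) ⟩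
      fromℕ 3 * (1# - y)
        ≈⟨ *-congˡ (trans (+-congʳ (sym x+y≈1)) (solve 2 (λ x y → (x :+ y) :- y := x) refl x y)) ⟩
      fromℕ 3 * x ∎)
      where
      0<3 : 0# < fromℕ 3
      0<3 = fromℕ-pos {3} (s≤s z≤n)

    accepts : _≐_ R p q → ⅔ R ≤ Pr accept
    accepts p≐q = ⅔≤ Pr-total (≤-respˡ (*-congˡ (sym Pr-reject)) (null-error λ i → *-congˡ (+-congʳ (query≈ i))))
      where
      query≈ : ∀ i → query R q i ≈ query R p i
      query≈ i with i ℕₚ.<? n
      ... | yes _ = sym (p≐q _)
      ... | no  _ = refl

    module _ (ε≤‖p-q‖ : ε ≤ ‖_-_‖₁ R p q) where

      -- Two distributions are at distance at most 2. This is what later allows `ε⁴` to be bounded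
      -- linearly in `χ`.
      ε≤2 : ε ≤ fromℕ 2
      ε≤2 = begin
        ε                                     ≤⟨ ε≤‖p-q‖ ⟩
        sum (λ i → ∣ mass p i - mass q i ∣)   ≤⟨ sum-mono-≤ (λ i → ∣x-y∣≤x+y (nonNeg p i) (nonNeg q i)) ⟩
        sum (λ i → mass p i + mass q i)       ≈⟨ ∑-distrib-+ (mass p) (mass q) ⟩
        sum (mass p) + sum (mass q)           ≈⟨ +-cong (total p) (total q) ⟩
        1# + 1#                               ≈⟨ solve 0 (:1 :+ :1 := :2) refl ⟩
        fromℕ 2                               ∎

      gap : ℕ → Carrier
      gap i = ∣ query R p i - query R q i ∣

      gap-out : ∀ i → n ℕ.≤ i → gap i ≈ 0#
      gap-out i n≤i = antisym
        (≤-respʳ (trans (+-cong (query-out p i n≤i) (query-out q i n≤i)) (+-identityʳ 0#))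
          (∣x-y∣≤x+y (query-nonNeg p i) (query-nonNeg q i)))
        (∣∣-nonNeg _)

      -- The uniform parts cancel in `b - a`, leaving half the original difference with the opposite
      -- sign. Comparing squares removes the sign.
      gap≤ : ∀ i → gap i ≤ fromℕ 2 * ∣ b i - a i ∣
      gap≤ i = square-cancel-≤ (*-nonNeg (fromℕ-nonNeg 2) (∣∣-nonNeg _)) (≤-reflexive (begin-equality
        gap i * gap i
          ≈⟨ ∣∣-square _ ⟩
        (x - y) * (x - y)
          ≈⟨ solve 2 (λ x y → (x :- y) :* (x :- y) := :1 :* :1 :* ((y :- x) :* (y :- x))) refl x y ⟩
        1# * 1# * ((y - x) * (y - x))
          ≈⟨ *-congʳ (*-cong 2½≈1 2½≈1) ⟨
        (fromℕ 2 * ½) * (fromℕ 2 * ½) * ((y - x) * (y - x))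
          ≈⟨ solve 5 (λ t h x y j → (t :* h) :* (t :* h) :* ((y :- x) :* (y :- x)) :=
               t :* t :* ((h :* (y :+ j) :- h :* (x :+ j)) :* (h :* (y :+ j) :- h :* (x :+ j)))) refl (fromℕ 2) ½ x y N⁻¹ ⟩
        fromℕ 2 * fromℕ 2 * ((½ * (y + N⁻¹) - ½ * (x + N⁻¹)) * (½ * (y + N⁻¹) - ½ * (x + N⁻¹)))
          ≈⟨ *-congˡ (*-cong b-a≈ b-a≈) ⟨
        fromℕ 2 * fromℕ 2 * ((b i - a i) * (b i - a i))
          ≈⟨ *-congˡ (∣∣-square _) ⟨
        fromℕ 2 * fromℕ 2 * (∣ b i - a i ∣ * ∣ b i - a i ∣)
          ≈⟨ solve 2 (λ t u → t :* t :* (u :* u) := (t :* u) :* (t :* u)) refl (fromℕ 2) ∣ b i - a i ∣ ⟩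
        (fromℕ 2 * ∣ b i - a i ∣) * (fromℕ 2 * ∣ b i - a i ∣) ∎))
        where
        x = query R p i
        y = query R q i
        b-a≈ : b i - a i ≈ ½ * (y + N⁻¹) - ½ * (x + N⁻¹)
        b-a≈ = +-cong (smoothed≈ q i) (-‿cong (smoothed≈ p i))

      ε≤2L : ε ≤ fromℕ 2 * ℓ₁-distance
      ε≤2L = begin
        ε                                        ≤⟨ ε≤‖p-q‖ ⟩
        sum (λ i → ∣ mass p i - mass q i ∣)      ≈⟨ sum≈∑< _ gap (λ i → ∣∣-cong (+-cong (sym (query-toℕ p i)) (-‿cong (sym (query-toℕ q i))))) gap-out ⟩
        ∑< N gap                                 ≤⟨ ∑<-mono N (λ i _ → gap≤ i) ⟩
        ∑< N (λ i → fromℕ 2 * ∣ b i - a i ∣)     ≈⟨ ∑<-* N _ _ ⟩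
        fromℕ 2 * ℓ₁-distance                    ∎

      rejects : ⅔ R ≤ Pr reject
      rejects = ⅔≤ (trans (+-comm _ _) Pr-total)
        (≤-respˡ (*-congˡ (sym Pr-accept)) (far-error ε≤2 ε≤2L))

  -- The asymptotic bound on the running time.

  timeConstant : ℕ → ℕ
  timeConstant κ = 24 ℕ.* (2 ℕ.* (κ ℕ.* κ ℕ.* κ) ℕ.+ 8)

  -- By minimality the predecessor `j` of a positive `m` still satisfies the loop test, so `j²` is
  -- at most `κ³n/ε⁴`. The excess in `m + 1 = j + 2` is absorbed by `(j + 2)² ≤ 2j² + 8`, which is
  -- `(j - 2)² ≥ 0`. As `1 + 1/ε` dominates both 1 and `1/ε`, its fourth power covers the constant 8
  -- and the case `m = 0` as well.
  samples² : ∀ {κ n m ε} → 1 ℕ.≤ n → (0<ε : 0# < ε) →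
    (∀ {j} → j ℕ.< m → fromℕ j * fromℕ j * (ε * ε * (ε * ε)) ≤ fromℕ κ * fromℕ κ * fromℕ κ * fromℕ n) →
    let x = 1# + ε ⁻¹ in
    fromℕ (suc m) * fromℕ (suc m) ≤
    (fromℕ 2 * (fromℕ κ * fromℕ κ * fromℕ κ) + fromℕ 8) * fromℕ n * (x * x * (x * x))
  samples² {κ} {n} {m} {ε} 1≤n 0<ε below = helper m below
    where
    e′ = ε ⁻¹
    x = 1# + e′
    C E : Carrier
    C = fromℕ κ * fromℕ κ * fromℕ κ
    E = x * x * (x * x)
    0≤C : 0# ≤ C
    0≤C = *-nonNeg (square-nonNeg _) (fromℕ-nonNeg κ)
    1≤x : 1# ≤ x
    1≤x = ≤-by (0≤e 0<ε) refl
    1≤* : ∀ {y z} → 1# ≤ y → 1# ≤ z → 1# ≤ y * z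
    1≤* 1≤y 1≤z = ≤-respˡ (*-identityʳ 1#) (*-mono-≤ (≤-trans 0≤1 1≤y) 0≤1 1≤y 1≤z)
    e≤x : e′ ≤ x
    e≤x = ≤-by 0≤1 (+-comm _ _)
    e²≤x² : e′ * e′ ≤ x * x
    e²≤x² = *-mono-≤ (≤-trans 0≤1 1≤x) (0≤e 0<ε) e≤x e≤x
    e⁴≤E : e′ * e′ * (e′ * e′) ≤ E
    e⁴≤E = *-mono-≤ (square-nonNeg x) (square-nonNeg e′) e²≤x² e²≤x²
    1≤nE : 1# ≤ fromℕ n * E
    1≤nE = 1≤* (1≤fromℕ 1≤n) (1≤* (1≤* 1≤x 1≤x) (1≤* 1≤x 1≤x))
    0≤nE : 0# ≤ fromℕ n * E
    0≤nE = ≤-trans 0≤1 1≤nE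
    helper : ∀ m → (∀ {j} → j ℕ.< m → fromℕ j * fromℕ j * (ε * ε * (ε * ε)) ≤ C * fromℕ n) →
      fromℕ (suc m) * fromℕ (suc m) ≤ (fromℕ 2 * C + fromℕ 8) * fromℕ n * E
    helper zero _ = begin
      fromℕ 1 * fromℕ 1
        ≈⟨ solve 0 (:n 1 :* :n 1 := :1) refl ⟩
      1#
        ≤⟨ 1≤nE ⟩
      fromℕ n * E
        ≤⟨ ≤-by (+-nonNeg (*-nonNeg (*-nonNeg (fromℕ-nonNeg 2) 0≤C) 0≤nE) (*-nonNeg (fromℕ-nonNeg 7) 0≤nE))
             (solve 3 (λ C n E → (:2 :* C :+ :n 8) :* n :* E := n :* E :+ (:2 :* C :* (n :* E) :+ :n 7 :* (n :* E))) refl C (fromℕ n) E) ⟩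
      (fromℕ 2 * C + fromℕ 8) * fromℕ n * E ∎
    helper (suc j) below = begin
      fromℕ (2 ℕ.+ j) * fromℕ (2 ℕ.+ j)
        ≤⟨ ≤-by (square-nonNeg (fromℕ j - fromℕ 2))
             (solve 1 (λ j → :2 :* (j :* j) :+ :n 8 := (:1 :+ (:1 :+ j)) :* (:1 :+ (:1 :+ j)) :+ (j :- :2) :* (j :- :2)) refl (fromℕ j)) ⟩
      fromℕ 2 * (fromℕ j * fromℕ j) + fromℕ 8
        ≤⟨ +-mono-≤ (*-monoˡ-≤ (fromℕ-nonNeg 2) (≤-trans (m²≤ 0<ε {j} (below ℕₚ.≤-refl)) (*-monoˡ-≤ (*-nonNeg 0≤C (fromℕ-nonNeg n)) e⁴≤E)))
             (≤-respˡ (*-identityʳ _) (*-monoˡ-≤ (fromℕ-nonNeg 8) 1≤nE)) ⟩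
      fromℕ 2 * (C * fromℕ n * E) + fromℕ 8 * (fromℕ n * E)
        ≈⟨ solve 3 (λ C n E → :2 :* (C :* n :* E) :+ :n 8 :* (n :* E) := (:2 :* C :+ :n 8) :* n :* E) refl C (fromℕ n) E ⟩
      (fromℕ 2 * C + fromℕ 8) * fromℕ n * E ∎

  time² : ∀ {κ n m t l ε} → 1 ℕ.≤ n → 1 ℕ.≤ l → (0<ε : 0# < ε) → t ℕ.≤ 24 ℕ.* (suc m ℕ.* l) →
    (∀ {j} → j ℕ.< m → fromℕ j * fromℕ j * (ε * ε * (ε * ε)) ≤ fromℕ κ * fromℕ κ * fromℕ κ * fromℕ n) →
    fromℕ t ^ 2 ≤ fromℕ n * (fromℕ (timeConstant κ) * fromℕ l ^ 2 * (1# + ε ⁻¹) ^ 2) ^ 2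
  time² {κ} {n} {m} {t} {l} {ε} 1≤n 1≤l 0<ε t≤ below = begin
    fromℕ t ^ 2
      ≈⟨ *-congˡ (*-identityʳ _) ⟩
    fromℕ t * fromℕ t
      ≤⟨ *-mono-≤ (≤-trans (fromℕ-nonNeg t) t≤′) (fromℕ-nonNeg t) t≤′ t≤′ ⟩
    (fromℕ 24 * (M * L)) * (fromℕ 24 * (M * L))
      ≈⟨ solve 3 (λ c M L → (c :* (M :* L)) :* (c :* (M :* L)) := (c :* L) :* (c :* L) :* (M :* M)) refl (fromℕ 24) M L ⟩
    (fromℕ 24 * L) * (fromℕ 24 * L) * (M * M)
      ≤⟨ *-monoˡ-≤ (square-nonNeg _) (samples² {κ} {n} {m} 1≤n 0<ε below) ⟩
    (fromℕ 24 * L) * (fromℕ 24 * L) * (C * fromℕ n * E)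
      ≈⟨ solve 4 (λ y C n E → y :* y :* (C :* n :* E) := (y :* y :* n :* E) :* (:1 :* C :* (:1 :* :1))) refl (fromℕ 24 * L) C (fromℕ n) E ⟩
    ((fromℕ 24 * L) * (fromℕ 24 * L) * fromℕ n * E) * (1# * C * (1# * 1#))
      -- One exponent must serve both polylogarithmic and polynomial factors. The dependence on
      -- `1/ε` calls for 2, so the logarithm is raised from 1 to 2; and `C` is replaced by its
      -- square, as it need not have a root.
      ≤⟨ *-monoˡ-≤ (*-nonNeg (*-nonNeg (square-nonNeg _) (fromℕ-nonNeg n)) (square-nonNeg (x * x)))
           (*-mono-≤ (square-nonNeg C) (*-nonNeg 0≤1 0≤1) (*-monoʳ-≤ (≤-trans 0≤1 1≤C) 1≤C)
             (*-mono-≤ (fromℕ-nonNeg l) 0≤1 1≤L 1≤L)) ⟩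
    ((fromℕ 24 * L) * (fromℕ 24 * L) * fromℕ n * E) * (C * C * (L * L))
      ≈⟨ solve 5 (λ c L n x C → ((c :* L) :* (c :* L) :* n :* (x :* x :* (x :* x))) :* (C :* C :* (L :* L)) :=
           n :* (((c :* C) :* (L :* (L :* :1)) :* (x :* (x :* :1))) :* (((c :* C) :* (L :* (L :* :1)) :* (x :* (x :* :1))) :* :1)))
           refl (fromℕ 24) L (fromℕ n) x C ⟩
    fromℕ n * ((fromℕ 24 * C) * L ^ 2 * x ^ 2) ^ 2
      ≈⟨ *-congˡ (^-cong² (*-congʳ (*-congʳ timeConstant≈))) ⟨
    fromℕ n * (fromℕ (timeConstant κ) * L ^ 2 * x ^ 2) ^ 2 ∎
    where
    M L x C E : Carrier
    M = fromℕ (suc m)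
    L = fromℕ l
    x = 1# + ε ⁻¹
    C = fromℕ 2 * (fromℕ κ * fromℕ κ * fromℕ κ) + fromℕ 8
    E = x * x * (x * x)
    ^-cong² : ∀ {y z} → y ≈ z → y ^ 2 ≈ z ^ 2
    ^-cong² y≈z = *-cong y≈z (*-congʳ y≈z)
    t≤′ : fromℕ t ≤ fromℕ 24 * (M * L)
    t≤′ = ≤-respʳ (trans (fromℕ-* 24 (suc m ℕ.* l)) (*-congˡ (fromℕ-* (suc m) l))) (fromℕ-mono-≤ t≤)
    1≤L : 1# ≤ L
    1≤L = 1≤fromℕ 1≤l
    1≤C : 1# ≤ C
    1≤C = ≤-by (+-nonNeg (*-nonNeg (fromℕ-nonNeg 2) (*-nonNeg (square-nonNeg _) (fromℕ-nonNeg κ))) (fromℕ-nonNeg 7))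
      (solve 1 (λ y → y :+ :n 8 := :1 :+ (y :+ :n 7)) refl _)
    timeConstant≈ : fromℕ (timeConstant κ) ≈ fromℕ 24 * C
    timeConstant≈ = trans (fromℕ-* 24 (2 ℕ.* (κ ℕ.* κ ℕ.* κ) ℕ.+ 8)) (*-congˡ
      (trans (fromℕ-+ (2 ℕ.* (κ ℕ.* κ ℕ.* κ)) 8) (+-congʳ
        (trans (fromℕ-* 2 (κ ℕ.* κ ℕ.* κ)) (*-congˡ
          (trans (fromℕ-* (κ ℕ.* κ) κ) (*-congʳ (fromℕ-* κ κ))))))))

mainTheorem1 : ∀ {c ℓ₁ ℓ₂} (R : OrderedField c ℓ₁ ℓ₂) →
    Σ[ P ∈ Program ] Σ[ T ∈ (ℕ → OrderedField.Carrier R → ℕ) ]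
    (IsIdentityTester R P × HasRunningTime R P T × IsÕ[√n·poly[1/ε]] R T)
mainTheorem1 R = tester , time
  , (λ {n} 1≤n ε 0<ε p q →
       (λ p≐q → time n ε , accepts 1≤n 0<ε p q p≐q) ,
       (λ far → time n ε , rejects 1≤n 0<ε p q far))
  , (λ 1≤n ε 0<ε p q → Pr-total 1≤n 0<ε p q)
  , timeConstant 64 , 2
  , (λ {n} 1≤n ε 0<ε → time² {64} {n} {samples n ε} 1≤n (s≤s z≤n) 0<ε
       (testerSteps≤ (samples n ε) (rounds≤1+log n) (s≤s z≤n))
       (λ j<m → ⌊≤?⌋-true (samples-more 0<ε n j<m)))
  where open IdentityTester R
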